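{- Let $n$ be divisible by $3$ and large enough that Waiter has a winning strategy in the unbiased Waiter-Client triangle-factor game on the edges of $K_n$. Then $$\tau_{WC}(\mathcal{F}_{n,K_3\text{ -fac}},1) \geq \tfrac{7}{6}n.$$
   Context: The unbiased Waiter-Client triangle-factor game on $K_n$ ($n$ divisible by $3$): initially all edges of $K_n$ are unclaimed. In each round Waiter picks two yet unclaimed edges and offers them to Client; Client chooses one of them to be added to Client's graph, and the other is added to Waiter's graph. Waiter wins if at some point Client's graph contains a $K_3$-factor (a collection of $n/3$ vertex-disjoint triangles covering all vertices); otherwise Client wins. $\tau_{WC}(\mathcal{F}_{n,K_3\text{ -fac}},1)$ denotes the number of rounds the game lasts when Waiter tries to win as fast as possible, Client tries to delay her as long as possible, and both play optimally. -}

module Defs where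

open import Data.Nat using (ℕ; zero; suc; _*_; _≤_; _<_)
open import Data.Fin as Fin using (Fin)
open import Data.Product using (Σ; ∃; _×_; _,_; proj₁; proj₂)
open import Data.Sum using (_⊎_)
open import Data.List using (List; []; _∷_; concatMap; allFin)
open import Data.List.Membership.Propositional using (_∈_; _∉_)
open import Data.List.Relation.Unary.All using (All)
open import Data.List.Relation.Binary.Permutation.Propositional using (_↭_)
open import Relation.Binary.PropositionalEquality using (_≡_; _≢_)
open import Relation.Nullary using (¬_)

-- An edge of K_n on vertex set Fin n: an unordered pair {i,j}, i ≠ j,
-- represented canonically as (i , j) with i < j.
Edge : ℕ → Set
Edge n = Σ (Fin n × Fin n) (λ p → proj₁ p Fin.< proj₂ p)

record Position (n : ℕ) : Set where
  constructor pos
  field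
    client : List (Edge n)
    waiter : List (Edge n)
open Position public

initial : (n : ℕ) → Position n
initial n = pos [] []

Free : {n : ℕ} → Position n → Edge n → Set
Free P e = (e ∉ client P) × (e ∉ waiter P)

Adj : {n : ℕ} → List (Edge n) → Fin n → Fin n → Set
Adj {n} G u v = Σ (u Fin.< v) (λ p → ((u , v) , p) ∈ G)
              ⊎ Σ (v Fin.< u) (λ p → ((v , u) , p) ∈ G)

Triangle : {n : ℕ} → List (Edge n) → Fin n × Fin n × Fin n → Set
Triangle G (a , b , c) = Adj G a b × Adj G b c × Adj G a c

vertsOf : {n : ℕ} → Fin n × Fin n × Fin n → List (Fin n)
vertsOf (a , b , c) = a ∷ b ∷ c ∷ []

-- G contains a K_3-factor: a collection of triangles of G which are
-- vertex-disjoint and cover every vertex, i.e. the list of all their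
-- vertices is a permutation of the full vertex list.
HasK3Factor : {n : ℕ} → List (Edge n) → Set
HasK3Factor {n} G =
  Σ (List (Fin n × Fin n × Fin n)) λ T →
    All (Triangle G) T × (concatMap vertsOf T ↭ allFin n)

-- Waiter (with Client playing arbitrarily) can force Client's graph to
-- contain a K_3-factor within at most k further rounds from position P.
-- A round: Waiter offers two distinct unclaimed edges e, f; Client takes
-- one of them, Waiter gets the other.
data WaiterWinsWithin {n : ℕ} : ℕ → Position n → Set where
  done  : ∀ {k P} → HasK3Factor (client P) → WaiterWinsWithin k P
  offer : ∀ {k P} (e f : Edge n) → e ≢ f → Free P e → Free P f →
          WaiterWinsWithin k (pos (e ∷ client P) (f ∷ waiter P)) →
          WaiterWinsWithin k (pos (f ∷ client P) (e ∷ waiter P)) →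
          WaiterWinsWithin (suc k) P

WaiterWins : ℕ → Set
WaiterWins n = ∃ λ k → WaiterWinsWithin k (initial n)

IsTauWC : ℕ → ℕ → Set
IsTauWC n t = WaiterWinsWithin t (initial n)
            × (∀ k → k < t → ¬ WaiterWinsWithin k (initial n))

{-# OPTIONS --safe #-}

-- In the end every component of Client's graph is a union of K factor triangles plus
-- W further ("wasted") edges, so the claim is that 2W - K, summed over the components,
-- is nonnegative. By connectedness W ≥ K - 1. Client keeps, for every component, a number
-- r of edges which are wasted in every factor that can still arise; then W ≥ r, so
-- 2W - K ≥ r - 1, with equality only if W = K - 1 = r (a "cheap" component: a tree of
-- triangles). Client never creates a cheap component unless both offered edges e and f
-- would do so. In that case they lie in distinct components, Client takes e, and because
-- the component of f is a tree of triangles minus the edge f, losing f to Waiter forces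
-- one more wasted edge there: its r increases by one. Hence the number of cheap components
-- never exceeds the sum of the r's, and the sum of 2W - K is nonnegative.
--
-- A factor is handled through a labelling of the vertices whose classes are its triangles;
-- its wasted edges are those crossing between classes.
module Submission where

open import Defs
open import Data.Nat using (ℕ; suc; _+_; _*_; _≤_; _<_; _≤?_; _≟_; z≤n; s≤s)
open import Data.Nat.Divisibility using (_∣_)
open import Data.Nat.ListAction using (sum)
open import Data.Nat.ListAction.Properties using (sum-↭)
open import Data.Nat.Properties hiding (_≟_; _≤?_)
open import Data.Nat.Tactic.RingSolver using (solve-∀)
open import Data.Fin as Fin using (Fin)
import Data.Fin.Properties as Fin
open import Data.Empty using (⊥; ⊥-elim)
open import Data.Product using (∃; ∃₂; _×_; _,_; proj₁; proj₂)
open import Data.Sum using (_⊎_; inj₁; inj₂)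
open import Data.List using (List; []; _∷_; _++_; length; map; filter; concatMap; allFin)
open import Data.List.Properties using (length-++; length-tabulate; ++-assoc; filter-++; filter-accept; filter-reject)
open import Data.List.Membership.Propositional using (_∈_; _∉_)
open import Data.List.Membership.Propositional.Properties using (∈-++⁺ˡ; ∈-++⁺ʳ; ∈-++⁻; ∈-filter⁺; ∈-filter⁻; ∈-∃++; ∈-allFin)
open import Data.List.Relation.Unary.Any using (here; there)
open import Data.List.Relation.Unary.All as All using (All; []; _∷_)
import Data.List.Relation.Unary.All.Properties as All
open import Data.List.Relation.Unary.AllPairs as AllPairs using (AllPairs; []; _∷_)
import Data.List.Relation.Unary.AllPairs.Properties as AllPairs
open import Data.List.Relation.Unary.Unique.Propositional using (Unique)
import Data.List.Relation.Unary.Unique.Propositional.Properties as Unique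
open import Data.List.Relation.Binary.Permutation.Propositional as Perm using (_↭_; ↭-refl; ↭-sym; ↭-trans; ↭-reflexive; prep; swap; ↭⇒↭ₛ)
open import Data.List.Relation.Binary.Permutation.Propositional.Properties using (All-resp-↭; ∈-resp-↭; ↭-length; ++⁺ˡ; shift; shifts; map⁺)
import Data.List.Relation.Binary.Permutation.Setoid.Properties as SetoidPerm
open import Function using (_∘_; id)
open import Level using (0ℓ)
open import Relation.Binary.PropositionalEquality using (_≡_; _≢_; refl; sym; trans; cong; cong₂; subst; subst₂; setoid; module ≡-Reasoning)
open import Relation.Nullary using (¬_; Dec; yes; no; ¬?; contradiction)
open import Relation.Nullary.Decidable using (decidable-stable)
open import Relation.Unary using (Pred; Decidable)

variable
  n : ℕ
  A : Set

-- Filtering and counting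

length-filter-¬ : {P : Pred A 0ℓ} (P? : Decidable P) (xs : List A) →
  length (filter P? xs) + length (filter (¬? ∘ P?) xs) ≡ length xs
length-filter-¬ P? [] = refl
length-filter-¬ P? (x ∷ xs) with P? x
... | yes _ = cong suc (length-filter-¬ P? xs)
... | no  _ = trans (+-suc _ _) (cong suc (length-filter-¬ P? xs))

module _ {P Q : Pred A 0ℓ} (P? : Decidable P) (Q? : Decidable Q) (P⊆Q : ∀ {x} → P x → Q x) where

  length-filter-mono : ∀ xs → length (filter P? xs) ≤ length (filter Q? xs)
  length-filter-mono [] = z≤n
  length-filter-mono (x ∷ xs) with P? x | Q? x
  ... | yes p | yes q = s≤s (length-filter-mono xs)
  ... | yes p | no ¬q = contradiction (P⊆Q p) ¬q
  ... | no ¬p | yes q = m≤n⇒m≤1+n (length-filter-mono xs)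
  ... | no ¬p | no ¬q = length-filter-mono xs

  length-filter-mono-< : ∀ {x} xs → x ∈ xs → Q x → ¬ P x →
    suc (length (filter P? xs)) ≤ length (filter Q? xs)
  length-filter-mono-< (x ∷ xs) (here refl) qx ¬px with P? x | Q? x
  ... | yes p | _     = contradiction p ¬px
  ... | no ¬p | yes q = s≤s (length-filter-mono xs)
  ... | no ¬p | no ¬q = contradiction qx ¬q
  length-filter-mono-< (y ∷ xs) (there x∈) qx ¬px with P? y | Q? y
  ... | yes p | yes q = s≤s (length-filter-mono-< xs x∈ qx ¬px)
  ... | yes p | no ¬q = contradiction (P⊆Q p) ¬q
  ... | no ¬p | yes q = m≤n⇒m≤1+n (length-filter-mono-< xs x∈ qx ¬px)
  ... | no ¬p | no ¬q = length-filter-mono-< xs x∈ qx ¬px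

  length-filter-mono-≪ : ∀ {x y} xs → x ∈ xs → y ∈ xs → x ≢ y → Q x → ¬ P x → Q y → ¬ P y →
    suc (suc (length (filter P? xs))) ≤ length (filter Q? xs)
  length-filter-mono-≪ (z ∷ xs) (here refl) (here refl) x≢y qx ¬px qy ¬py = contradiction refl x≢y
  length-filter-mono-≪ (z ∷ xs) (here refl) (there y∈) x≢y qx ¬px qy ¬py with P? z | Q? z
  ... | yes p | _     = contradiction p ¬px
  ... | no ¬p | yes q = s≤s (length-filter-mono-< xs y∈ qy ¬py)
  ... | no ¬p | no ¬q = contradiction qx ¬q
  length-filter-mono-≪ (z ∷ xs) (there x∈) (here refl) x≢y qx ¬px qy ¬py with P? z | Q? z
  ... | yes p | _     = contradiction p ¬py
  ... | no ¬p | yes q = s≤s (length-filter-mono-< xs x∈ qx ¬px)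
  ... | no ¬p | no ¬q = contradiction qy ¬q
  length-filter-mono-≪ (z ∷ xs) (there x∈) (there y∈) x≢y qx ¬px qy ¬py with P? z | Q? z
  ... | yes p | yes q = s≤s (length-filter-mono-≪ xs x∈ y∈ x≢y qx ¬px qy ¬py)
  ... | yes p | no ¬q = contradiction (P⊆Q p) ¬q
  ... | no ¬p | yes q = m≤n⇒m≤1+n (length-filter-mono-≪ xs x∈ y∈ x≢y qx ¬px qy ¬py)
  ... | no ¬p | no ¬q = length-filter-mono-≪ xs x∈ y∈ x≢y qx ¬px qy ¬py

sum-map-+ : (f g : A → ℕ) (xs : List A) →
  sum (map (λ x → f x + g x) xs) ≡ sum (map f xs) + sum (map g xs)
sum-map-+ f g [] = refl
sum-map-+ f g (x ∷ xs) = trans (cong (f x + g x +_) (sum-map-+ f g xs))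
  (shuffle (f x) (g x) (sum (map f xs)) (sum (map g xs)))
  where
  shuffle : ∀ a b c d → a + b + (c + d) ≡ a + c + (b + d)
  shuffle = solve-∀

module _ (f : A → ℕ) (c : ℕ) where

  sum-map-≤ : ∀ {xs} → All (λ x → f x ≤ c) xs → sum (map f xs) ≤ c * length xs
  sum-map-≤ {[]} [] = z≤n
  sum-map-≤ {x ∷ xs} (p ∷ ps) =
    subst (f x + sum (map f xs) ≤_) (sym (*-suc c (length xs))) (+-mono-≤ p (sum-map-≤ ps))

  sum-map-≥ : ∀ {xs} → All (λ x → c ≤ f x) xs → c * length xs ≤ sum (map f xs)
  sum-map-≥ {[]} [] = ≤-reflexive (*-zeroʳ c)
  sum-map-≥ {x ∷ xs} (p ∷ ps) =
    subst (_≤ f x + sum (map f xs)) (sym (*-suc c (length xs))) (+-mono-≤ p (sum-map-≥ ps))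

  -- The other terms are at most `c` each, so a single term below `c` could not be made up for.
  sum-map-saturated : ∀ {xs x} → All (λ x → f x ≤ c) xs → c * length xs ≤ sum (map f xs) →
    x ∈ xs → c ≤ f x
  sum-map-saturated {y ∷ xs} (p ∷ ps) h (here refl) =
    +-cancelʳ-≤ (c * length xs) c (f y)
      (≤-trans (subst (_≤ f y + sum (map f xs)) (*-suc c (length xs)) h)
               (+-monoʳ-≤ (f y) (sum-map-≤ ps)))
  sum-map-saturated {y ∷ xs} (p ∷ ps) h (there x∈) = sum-map-saturated ps
    (+-cancelˡ-≤ c (c * length xs) (sum (map f xs))
      (≤-trans (subst (_≤ f y + sum (map f xs)) (*-suc c (length xs)) h)
               (+-monoˡ-≤ (sum (map f xs)) p))) x∈

two-members : ∀ {x y : A} {xs} → x ∈ xs → y ∈ xs → x ≢ y → 2 ≤ length xs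
two-members (here refl) (here refl) x≢y = contradiction refl x≢y
two-members {xs = _ ∷ _ ∷ _} (here _) (there _) _ = s≤s (s≤s z≤n)
two-members {xs = _ ∷ _ ∷ _} (there _) (here _) _ = s≤s (s≤s z≤n)
two-members (there x∈) (there y∈) x≢y = m≤n⇒m≤1+n (two-members x∈ y∈ x≢y)

-- Edges, neighbours and degrees

src dst : Edge n → Fin n
src = proj₁ ∘ proj₁
dst = proj₂ ∘ proj₁

src≢dst : (e : Edge n) → src e ≢ dst e
src≢dst (_ , p) eq = Fin.<-irrefl eq p

Ends : List (Fin n) → Edge n → Set
Ends V e = (src e ∈ V) × (dst e ∈ V)

∈⇒Adj : {E : List (Edge n)} {e : Edge n} → e ∈ E → Adj E (src e) (dst e)
∈⇒Adj {e = _ , p} e∈ = inj₁ (p , e∈)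

Adj-sym : {E : List (Edge n)} {u v : Fin n} → Adj E u v → Adj E v u
Adj-sym (inj₁ a) = inj₂ a
Adj-sym (inj₂ a) = inj₁ a

Adj-mono : {E F : List (Edge n)} {u v : Fin n} → (∀ {e} → e ∈ E → e ∈ F) → Adj E u v → Adj F u v
Adj-mono E⊆F (inj₁ (p , e∈)) = inj₁ (p , E⊆F e∈)
Adj-mono E⊆F (inj₂ (p , e∈)) = inj₂ (p , E⊆F e∈)

Adj⇒≢ : {E : List (Edge n)} {u v : Fin n} → Adj E u v → u ≢ v
Adj⇒≢ (inj₁ (p , _)) refl = Fin.<-irrefl refl p
Adj⇒≢ (inj₂ (p , _)) refl = Fin.<-irrefl refl p

Adj⇒∈ : {E : List (Edge n)} (e : Edge n) → Adj E (src e) (dst e) → e ∈ E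
-- An edge carries a proof that its ends are ordered; uniqueness of that proof identifies the two
-- edges.
Adj⇒∈ {E = E} ((a , b) , q) (inj₁ (p , e∈)) = subst (λ q → ((a , b) , q) ∈ E) (<-irrelevant p q) e∈
Adj⇒∈ ((a , b) , q) (inj₂ (p , _)) = contradiction p (<-asym q)

Adj-Ends : {E : List (Edge n)} {V : List (Fin n)} {u v : Fin n} → All (Ends V) E → Adj E u v → u ∈ V × v ∈ V
Adj-Ends ends (inj₁ (_ , e∈)) = All.lookup ends e∈
Adj-Ends ends (inj₂ (_ , e∈)) = let (a , b) = All.lookup ends e∈ in b , a

Joins : Edge n → Fin n → Fin n → Set
Joins e u v = (u ≡ src e × v ≡ dst e) ⊎ (u ≡ dst e × v ≡ src e)

Adj⇒Joins : {E : List (Edge n)} {u v : Fin n} → Adj E u v → ∃ λ e → e ∈ E × Joins e u v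
Adj⇒Joins {u = u} {v} (inj₁ (p , e∈)) = ((u , v) , p) , e∈ , inj₁ (refl , refl)
Adj⇒Joins {u = u} {v} (inj₂ (p , e∈)) = ((v , u) , p) , e∈ , inj₂ (refl , refl)

Joins-unique : ∀ {e : Edge n} {a b x y} → Joins e a b → Joins e x y → (x ≡ a × y ≡ b) ⊎ (x ≡ b × y ≡ a)
Joins-unique (inj₁ (refl , refl)) (inj₁ (refl , refl)) = inj₁ (refl , refl)
Joins-unique (inj₁ (refl , refl)) (inj₂ (refl , refl)) = inj₂ (refl , refl)
Joins-unique (inj₂ (refl , refl)) (inj₁ (refl , refl)) = inj₂ (refl , refl)
Joins-unique (inj₂ (refl , refl)) (inj₂ (refl , refl)) = inj₁ (refl , refl)

when : {P : Set} → Dec P → A → List A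
when (yes _) x = x ∷ []
when (no _)  x = []

-- A list with at most one entry, so that neighbours are gathered by concatenation and degrees are
-- lengths.
opposite : Fin n → Edge n → List (Fin n)
opposite v e = when (v Fin.≟ src e) (dst e) ++ when (v Fin.≟ dst e) (src e)

nbrs : Fin n → List (Edge n) → List (Fin n)
nbrs v []      = []
nbrs v (e ∷ E) = opposite v e ++ nbrs v E

∈-opposite⁻ : ∀ {v x : Fin n} e → x ∈ opposite v e → Joins e v x
∈-opposite⁻ {v = v} e x∈ with v Fin.≟ src e | v Fin.≟ dst e
∈-opposite⁻ e (here refl)         | yes p | _     = inj₁ (p , refl)
∈-opposite⁻ e (there (here refl)) | yes p | yes q = inj₂ (q , refl)
∈-opposite⁻ e (here refl)         | no  _ | yes q = inj₂ (q , refl)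

dst∈opposite : (e : Edge n) → dst e ∈ opposite (src e) e
dst∈opposite e with src e Fin.≟ src e
... | yes _ = here refl
... | no ¬p = contradiction refl ¬p

src∈opposite : (e : Edge n) → src e ∈ opposite (dst e) e
src∈opposite e with dst e Fin.≟ src e | dst e Fin.≟ dst e
... | yes p | _     = contradiction (sym p) (src≢dst e)
... | no _  | yes _ = here refl
... | no _  | no ¬p = contradiction refl ¬p

opposite-unique : ∀ (v : Fin n) e → Unique (opposite v e)
opposite-unique v e with v Fin.≟ src e | v Fin.≟ dst e
... | yes p | yes q = contradiction (trans (sym p) q) (src≢dst e)
... | yes p | no _  = [] ∷ []
... | no _  | yes q = [] ∷ []
... | no _  | no _  = []

∈-nbrs⁻ : ∀ {v x : Fin n} E → x ∈ nbrs v E → Adj E v x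
∈-nbrs⁻ {v = v} (e ∷ E) x∈ with ∈-++⁻ (opposite v e) x∈
... | inj₂ x∈ = Adj-mono there (∈-nbrs⁻ E x∈)
... | inj₁ x∈ with ∈-opposite⁻ {v = v} e x∈
...   | inj₁ (refl , refl) = ∈⇒Adj (here refl)
...   | inj₂ (refl , refl) = Adj-sym (∈⇒Adj (here refl))

∈-nbrs⁺ : ∀ {v x : Fin n} E → Adj E v x → x ∈ nbrs v E
∈-nbrs⁺ (e ∷ E) (inj₁ (p , here refl)) = ∈-++⁺ˡ (dst∈opposite e)
∈-nbrs⁺ (e ∷ E) (inj₂ (p , here refl)) = ∈-++⁺ˡ (src∈opposite e)
∈-nbrs⁺ {v = v} (e ∷ E) (inj₁ (p , there e∈)) = ∈-++⁺ʳ (opposite v e) (∈-nbrs⁺ E (inj₁ (p , e∈)))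
∈-nbrs⁺ {v = v} (e ∷ E) (inj₂ (p , there e∈)) = ∈-++⁺ʳ (opposite v e) (∈-nbrs⁺ E (inj₂ (p , e∈)))

nbrs-unique : ∀ (v : Fin n) {E} → Unique E → Unique (nbrs v E)
nbrs-unique v [] = []
nbrs-unique v {e ∷ E} (e∉ ∷ uE) = Unique.++⁺ (opposite-unique v e) (nbrs-unique v uE) disjoint
  where
  disjoint : ∀ {x} → ¬ (x ∈ opposite v e × x ∈ nbrs v E)
  disjoint (x∈o , x∈E) with ∈-opposite⁻ {v = v} e x∈o | ∈-nbrs⁻ E x∈E
  ... | inj₁ (refl , refl) | a = All.lookup e∉ (Adj⇒∈ e a) refl
  ... | inj₂ (refl , refl) | a = All.lookup e∉ (Adj⇒∈ e (Adj-sym a)) refl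

degree : List (Edge n) → Fin n → ℕ
degree E v = length (nbrs v E)

-- The indicator of `v ≡ a`, phrased through `when` so that `degree-∷` is definitional once both
-- comparisons are decided.
hits : Fin n → Fin n → ℕ
hits a v = length (when (v Fin.≟ a) v)

sum-hits-∉ : ∀ {a : Fin n} V → a ∉ V → sum (map (hits a) V) ≡ 0
sum-hits-∉ [] _ = refl
sum-hits-∉ {a = a} (v ∷ V) a∉ with v Fin.≟ a
... | yes refl = contradiction (here refl) a∉
... | no _     = sum-hits-∉ V (a∉ ∘ there)

sum-hits : ∀ {a : Fin n} {V} → Unique V → a ∈ V → sum (map (hits a) V) ≡ 1
sum-hits {a = a} {v ∷ V} uV@(_ ∷ _) (here refl) with v Fin.≟ v
... | yes _ = cong suc (sum-hits-∉ V (Unique.Unique[x∷xs]⇒x∉xs uV))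
... | no ¬p = contradiction refl ¬p
sum-hits {a = a} {v ∷ V} (v∉ ∷ uV) (there a∈) with v Fin.≟ a
... | yes refl = contradiction refl (All.lookup v∉ a∈)
... | no _     = sum-hits uV a∈

degree-∷ : ∀ (e : Edge n) E v → degree (e ∷ E) v ≡ (hits (src e) v + hits (dst e) v) + degree E v
degree-∷ e E v with v Fin.≟ src e | v Fin.≟ dst e
... | yes _ | yes _ = refl
... | yes _ | no _  = refl
... | no _  | yes _ = refl
... | no _  | no _  = refl

sum-map-cong : {f g : A → ℕ} → (∀ x → f x ≡ g x) → ∀ xs → sum (map f xs) ≡ sum (map g xs)
sum-map-cong h [] = refl
sum-map-cong h (x ∷ xs) = cong₂ _+_ (h x) (sum-map-cong h xs)

-- Induction on the edges: a new edge adds one at each end, and each end occurs exactly once in `V`.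
handshake : ∀ {V : List (Fin n)} {E} → Unique V → All (Ends V) E → sum (map (degree E) V) ≡ 2 * length E
handshake {V = V} {[]} uV [] = zeros V
  where
  zeros : ∀ V → sum (map (degree []) V) ≡ 0
  zeros []      = refl
  zeros (_ ∷ V) = zeros V
handshake {V = V} {e ∷ E} uV ((s∈ , d∈) ∷ ends) = begin
  sum (map (degree (e ∷ E)) V)
    ≡⟨ sum-map-cong (degree-∷ e E) V ⟩
  sum (map (λ v → (hits (src e) v + hits (dst e) v) + degree E v) V)
    ≡⟨ sum-map-+ (λ v → hits (src e) v + hits (dst e) v) (degree E) V ⟩
  sum (map (λ v → hits (src e) v + hits (dst e) v) V) + sum (map (degree E) V)
    ≡⟨ cong₂ _+_ (trans (sum-map-+ (hits (src e)) (hits (dst e)) V)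
                        (cong₂ _+_ (sum-hits uV s∈) (sum-hits uV d∈)))
                 (handshake uV ends) ⟩
  2 + 2 * length E
    ≡⟨ sym (*-suc 2 (length E)) ⟩
  2 * length (e ∷ E) ∎
  where open ≡-Reasoning

-- Labellings with classes of size at most three

Labelling : ℕ → Set
Labelling n = Fin n → ℕ

Within : Labelling n → Edge n → Set
Within σ e = σ (src e) ≡ σ (dst e)

within? : (σ : Labelling n) → Decidable (Within σ)
within? σ e = σ (src e) ≟ σ (dst e)

inner : Labelling n → List (Edge n) → List (Edge n)
inner σ = filter (within? σ)

crossing : Labelling n → List (Edge n) → ℕ
crossing σ E = length (filter (¬? ∘ within? σ) E)

Classes≤3 : Labelling n → Set
Classes≤3 σ = ∀ {L} ℓ → Unique L → All (λ v → σ v ≡ ℓ) L → length L ≤ 3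

inner+crossing : ∀ (σ : Labelling n) E → length (inner σ E) + crossing σ E ≡ length E
inner+crossing σ = length-filter-¬ (within? σ)

-- One vertex for each of several classes; the length of such a list stands in for a number of
-- classes.
Separated : Labelling n → List (Fin n) → Set
Separated σ = AllPairs (λ u v → σ u ≢ σ v)

Separated-injective : ∀ {σ : Labelling n} {L u v} → Separated σ L → u ∈ L → v ∈ L → σ u ≡ σ v → u ≡ v
Separated-injective _ (here refl) (here refl) _ = refl
Separated-injective (p ∷ _) (here refl) (there v∈) eq = contradiction eq (All.lookup p v∈)
Separated-injective (p ∷ _) (there u∈) (here refl) eq = contradiction (sym eq) (All.lookup p u∈)
Separated-injective (_ ∷ s) (there u∈) (there v∈) eq = Separated-injective s u∈ v∈ eq

Joins-Within : ∀ {σ : Labelling n} {e u v} → Joins e u v → σ u ≡ σ v → Within σ e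
Joins-Within (inj₁ (refl , refl)) eq = eq
Joins-Within (inj₂ (refl , refl)) eq = sym eq

Within-Joins : ∀ {σ : Labelling n} {e u v} → Joins e u v → Within σ e → σ u ≡ σ v
Within-Joins (inj₁ (refl , refl)) eq = eq
Within-Joins (inj₂ (refl , refl)) eq = sym eq

Adj-Within : ∀ {σ : Labelling n} {E u v} → All (Within σ) E → Adj E u v → σ u ≡ σ v
Adj-Within ws (inj₁ (_ , e∈)) = All.lookup ws e∈
Adj-Within ws (inj₂ (_ , e∈)) = sym (All.lookup ws e∈)

no-four : ∀ {σ : Labelling n} → Classes≤3 σ → ∀ {a b c d} → a ≢ b → a ≢ c → a ≢ d → b ≢ c → b ≢ d → c ≢ d →
  σ b ≡ σ a → σ c ≡ σ a → σ d ≡ σ a → ⊥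
no-four {σ = σ} σ≤3 {a} {b} {c} {d} ab ac ad bc bd cd eb ec ed
  with σ≤3 {a ∷ b ∷ c ∷ d ∷ []} (σ a)
         ((ab ∷ ac ∷ ad ∷ []) ∷ (bc ∷ bd ∷ []) ∷ (cd ∷ []) ∷ [] ∷ []) (refl ∷ eb ∷ ec ∷ ed ∷ [])
... | s≤s (s≤s (s≤s ()))

-- Greedy choice: keep `v`, discard its class, which costs at most three vertices, and continue. The
-- number `m` drives the recursion, since filtering is not structural.
representatives : ∀ {σ : Labelling n} → Classes≤3 σ → ∀ m V → length V ≤ m → Unique V →
  ∃ λ L → All (_∈ V) L × Separated σ L × length V ≤ 3 * length L
representatives σ≤3 m [] _ _ = [] , [] , [] , z≤n
representatives {σ = σ} σ≤3 (suc m) (v ∷ V) (s≤s V≤m) (v∉ ∷ uV) =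
  v ∷ L , here refl ∷ All.map (there ∘ proj₁ ∘ ∈-filter⁻ other?) L⊆
        , All.map (λ x∈ eq → proj₂ (∈-filter⁻ other? {xs = V} x∈) (sym eq)) L⊆ ∷ sep
        , bound
  where
  same? : Decidable (λ x → σ x ≡ σ v)
  same? x = σ x ≟ σ v
  other? : Decidable (λ x → ¬ (σ x ≡ σ v))
  other? = ¬? ∘ same?
  rec = representatives σ≤3 m (filter other? V)
    (≤-trans (m≤n+m _ _) (≤-trans (≤-reflexive (length-filter-¬ same? V)) V≤m)) (Unique.filter⁺ other? uV)
  L = proj₁ rec
  L⊆ = proj₁ (proj₂ rec)
  sep = proj₁ (proj₂ (proj₂ rec))
  bound : suc (length V) ≤ 3 * suc (length L)
  bound = begin
    suc (length V) ≡⟨ cong suc (sym (length-filter-¬ same? V)) ⟩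
    length (v ∷ filter same? V) + length (filter other? V)
      ≤⟨ +-mono-≤ (σ≤3 (σ v) (All.filter⁺ same? v∉ ∷ Unique.filter⁺ same? uV) (refl ∷ All.all-filter same? V))
                  (proj₂ (proj₂ (proj₂ rec))) ⟩
    3 + 3 * length L ≡⟨ sym (*-suc 3 (length L)) ⟩
    3 * suc (length L) ∎
    where open ≤-Reasoning

-- Graphs whose edges stay within classes of size at most three

module _ {V : List (Fin n)} {E : List (Edge n)} {σ : Labelling n}
         (uV : Unique V) (uE : Unique E) (ends : All (Ends V) E) (within : All (Within σ) E)
         (σ≤3 : Classes≤3 σ) where

  -- A vertex and its neighbours share one label, so together they are at most three.
  degree≤2 : ∀ v → degree E v ≤ 2
  degree≤2 v with σ≤3 {v ∷ nbrs v E} (σ v)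
    (All.tabulate (λ x∈ → Adj⇒≢ (∈-nbrs⁻ E x∈)) ∷ nbrs-unique v uE)
    (refl ∷ All.tabulate (λ x∈ → sym (Adj-Within within (∈-nbrs⁻ E x∈))))
  ... | s≤s h = h

  -- Handshake with all degrees at most two. Disjoint triangles attain equality, and the module
  -- below shows that nothing else does.
  within⇒edges≤vertices : length E ≤ length V
  within⇒edges≤vertices = *-cancelˡ-≤ 2
    (≤-trans (≤-reflexive (sym (handshake uV ends)))
             (sum-map-≤ (degree E) 2 {V} (All.tabulate (λ {v} _ → degree≤2 v))))

  module _ (V≤E : length V ≤ length E) where

    degree≥2 : ∀ {v} → v ∈ V → 2 ≤ degree E v
    degree≥2 = sum-map-saturated (degree E) 2 {V} (All.tabulate (λ {v} _ → degree≤2 v))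
      (≤-trans (*-monoʳ-≤ 2 V≤E) (≤-reflexive (sym (handshake uV ends))))

    two-nbrs : ∀ {v} → v ∈ V → ∃₂ λ p q → p ≢ q × Adj E v p × Adj E v q
    two-nbrs {v} v∈ with nbrs v E in eq | degree≥2 v∈ | nbrs-unique v uE
    ... | p ∷ q ∷ _ | _ | (p∉ ∷ _) ∷ _ = p , q , p∉
      , ∈-nbrs⁻ E (subst (p ∈_) (sym eq) (here refl))
      , ∈-nbrs⁻ E (subst (q ∈_) (sym eq) (there (here refl)))
    ... | _ ∷ [] | s≤s () | _
    ... | []     | ()     | _

    -- All degrees are two here. With `p` and `q` the neighbours of `v`, the second neighbour of `p`
    -- must be `q`, since otherwise the class of `v` would have four members.
    saturated⇒triangle : ∀ {v} → v ∈ V → ∃₂ λ p q → Triangle E (v , p , q)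
    saturated⇒triangle {v} v∈ = p , q , vp , closing , vq
      where
      tn = two-nbrs v∈
      p = proj₁ tn
      q = proj₁ (proj₂ tn)
      p≢q = proj₁ (proj₂ (proj₂ tn))
      vp = proj₁ (proj₂ (proj₂ (proj₂ tn)))
      vq = proj₂ (proj₂ (proj₂ (proj₂ tn)))
      third : ∀ z → Adj E p z → z ≢ v → Adj E p q
      third z pz z≢v with z Fin.≟ q
      ... | yes refl = pz
      ... | no z≢q = ⊥-elim (no-four σ≤3 (Adj⇒≢ vp) (Adj⇒≢ vq) (z≢v ∘ sym) p≢q (Adj⇒≢ pz) (z≢q ∘ sym)
              (sym (Adj-Within within vp)) (sym (Adj-Within within vq))
              (sym (trans (Adj-Within within vp) (Adj-Within within pz))))
      closing : Adj E p q
      closing with two-nbrs (proj₂ (Adj-Ends ends vp))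
      ... | a , b , a≢b , pa , pb with a Fin.≟ v
      ...   | no a≢v   = third a pa a≢v
      ...   | yes refl = third b pb (a≢b ∘ sym)

-- Connectedness expressed by labellings: a set meeting k classes of a labelling
-- is joined by at least k - 1 crossing edges.
Connected : List (Fin n) → List (Edge n) → Set
Connected V E = ∀ σ {L} → All (_∈ V) L → Separated σ L → length L ≤ suc (crossing σ E)

crossing-∷-within : ∀ {σ : Labelling n} {e} E → Within σ e → crossing σ (e ∷ E) ≡ crossing σ E
crossing-∷-within {σ = σ} E w = cong length (filter-reject (¬? ∘ within? σ) {xs = E} (λ ¬w → ¬w w))

crossing-∷-¬within : ∀ {σ : Labelling n} {e} E → ¬ Within σ e → crossing σ (e ∷ E) ≡ suc (crossing σ E)
crossing-∷-¬within {σ = σ} E ¬w = cong length (filter-accept (¬? ∘ within? σ) {xs = E} ¬w)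

crossing-∷ : ∀ (σ : Labelling n) e E → crossing σ E ≤ crossing σ (e ∷ E)
crossing-∷ σ e E with within? σ e
... | yes w = ≤-reflexive (sym (crossing-∷-within {σ = σ} {e} E w))
... | no ¬w = ≤-trans (n≤1+n _) (≤-reflexive (sym (crossing-∷-¬within {σ = σ} {e} E ¬w)))

crossing-++ : ∀ (σ : Labelling n) E F → crossing σ (E ++ F) ≡ crossing σ E + crossing σ F
crossing-++ σ E F = trans (cong length (filter-++ (¬? ∘ within? σ) E F))
  (length-++ (filter (¬? ∘ within? σ) E))

singleton-connected : (v : Fin n) → Connected (v ∷ []) []
singleton-connected v σ {[]} _ _ = z≤n
singleton-connected v σ {_ ∷ []} _ _ = s≤s z≤n
singleton-connected v σ {_ ∷ _ ∷ _} (here refl ∷ here refl ∷ _) ((x≢y ∷ _) ∷ _) = contradiction refl x≢y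

∷-connected : ∀ {V : List (Fin n)} {E} e → Connected V E → Connected V (e ∷ E)
∷-connected e conn σ L⊆ sep = ≤-trans (conn σ L⊆ sep) (s≤s (crossing-∷ σ e _))

-- Applying connectedness to both sides gives a bound that is one too large. If `e` crosses, it
-- supplies the missing crossing edge. If not, its ends share a class, which `L` represents on at
-- most one side; on the other side the end of `e` can be added as a further representative,
-- improving that bound by one.
bridge-connected : ∀ {V W : List (Fin n)} {E F} e → src e ∈ V → dst e ∈ W →
  Connected V E → Connected W F → Connected (V ++ W) (e ∷ (E ++ F))
bridge-connected {V = V} {W} {E} {F} e s∈ d∈ connV connW σ {L} L⊆ sep = goal
  where
  open import Data.List.Membership.DecPropositional Fin._≟_ using (_∈?_)
  open ≤-Reasoning
  L₁ = filter (_∈? V) L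
  L₂ = filter (¬? ∘ (_∈? V)) L
  L₁⊆ : All (_∈ V) L₁
  L₁⊆ = All.all-filter (_∈? V) L
  L₂⊆ : All (_∈ W) L₂
  L₂⊆ = All.tabulate λ x∈ → inW (∈-filter⁻ (¬? ∘ (_∈? V)) {xs = L} x∈)
    where
    inW : ∀ {x} → x ∈ L × x ∉ V → x ∈ W
    inW (x∈L , x∉V) with ∈-++⁻ V (All.lookup L⊆ x∈L)
    ... | inj₁ x∈V = contradiction x∈V x∉V
    ... | inj₂ x∈W = x∈W
  sep₁ = AllPairs.filter⁺ (_∈? V) sep
  sep₂ = AllPairs.filter⁺ (¬? ∘ (_∈? V)) sep
  crossing-E++F : crossing σ E + crossing σ F ≤ crossing σ (e ∷ (E ++ F))
  crossing-E++F = ≤-trans (≤-reflexive (sym (crossing-++ σ E F))) (crossing-∷ σ e (E ++ F))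
  goal : length L ≤ suc (crossing σ (e ∷ (E ++ F)))
  goal with within? σ e
  ... | no ¬w = begin
    length L                                    ≡⟨ sym (length-filter-¬ (_∈? V) L) ⟩
    length L₁ + length L₂                       ≤⟨ +-mono-≤ (connV σ L₁⊆ sep₁) (connW σ L₂⊆ sep₂) ⟩
    suc (crossing σ E) + suc (crossing σ F)     ≡⟨ +-suc (suc (crossing σ E)) _ ⟩
    suc (suc (crossing σ E + crossing σ F))     ≡⟨ cong (suc ∘ suc) (sym (crossing-++ σ E F)) ⟩
    suc (suc (crossing σ (E ++ F)))             ≡⟨ cong suc (sym (crossing-∷-¬within {σ = σ} {e} (E ++ F) ¬w)) ⟩
    suc (crossing σ (e ∷ (E ++ F)))             ∎
  ... | yes w with All.all? (λ x → ¬? (σ x ≟ σ (src e))) L₁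
  ...   | yes avoid = begin
    length L                                    ≡⟨ sym (length-filter-¬ (_∈? V) L) ⟩
    length L₁ + length L₂
      ≤⟨ +-mono-≤ (≤-pred (connV σ (s∈ ∷ L₁⊆) (All.map (_∘ sym) avoid ∷ sep₁))) (connW σ L₂⊆ sep₂) ⟩
    crossing σ E + suc (crossing σ F)           ≡⟨ +-suc (crossing σ E) _ ⟩
    suc (crossing σ E + crossing σ F)           ≤⟨ s≤s crossing-E++F ⟩
    suc (crossing σ (e ∷ (E ++ F)))             ∎
  ...   | no meets = begin
    length L                                    ≡⟨ sym (length-filter-¬ (_∈? V) L) ⟩
    length L₁ + length L₂
      ≤⟨ +-mono-≤ (connV σ L₁⊆ sep₁) (≤-pred (connW σ (d∈ ∷ L₂⊆) (avoid ∷ sep₂))) ⟩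
    suc (crossing σ E) + crossing σ F           ≤⟨ s≤s crossing-E++F ⟩
    suc (crossing σ (e ∷ (E ++ F)))             ∎
    where
    avoid : All (λ x → σ (dst e) ≢ σ x) L₂
    -- Some member of `L₁` has the label of `e`; a member of `L₂` with that label would equal it and
    -- lie in `V`.
    avoid = All.tabulate λ {y} y∈ eq → meets (All.tabulate λ {x} x∈ eq′ →
      let (y∈L , y∉V) = ∈-filter⁻ (¬? ∘ (_∈? V)) {xs = L} y∈
          (x∈L , x∈V) = ∈-filter⁻ (_∈? V) {xs = L} x∈
      in y∉V (subst (_∈ V) (Separated-injective sep x∈L y∈L (trans eq′ (trans w eq))) x∈V))

-- A labelling is tight if its crossing edges form a tree on its classes.
Tight : List (Fin n) → List (Edge n) → Labelling n → Set
Tight V E σ = ∃ λ L → All (_∈ V) L × Separated σ L × crossing σ E < length L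

-- Merging two classes of a tight labelling

redirect : ℕ → ℕ → ℕ → ℕ
redirect a b x with x ≟ b
... | yes _ = a
... | no _  = x

redirect-≡ : ∀ a b → redirect a b b ≡ a
redirect-≡ a b with b ≟ b
... | yes _ = refl
... | no ¬p = contradiction refl ¬p

redirect-≢ : ∀ a {b x} → x ≢ b → redirect a b x ≡ x
redirect-≢ a {b} {x} x≢b with x ≟ b
... | yes p = contradiction p x≢b
... | no _  = refl

module _ {V : List (Fin n)} {E : List (Edge n)} (conn : Connected V E) where

  module _ {σ : Labelling n} (tight : Tight V E σ) {a b : Fin n} (ab : Adj E a b) (a≁b : σ a ≢ σ b) where

    merged : Labelling n
    merged = redirect (σ a) (σ b) ∘ σ

    merged-≡ : merged a ≡ merged b
    merged-≡ = trans (redirect-≢ (σ a) a≁b) (sym (redirect-≡ (σ a) (σ b)))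

    private
      e = proj₁ (Adj⇒Joins ab)
      e∈ = proj₁ (proj₂ (Adj⇒Joins ab))
      e-ab = proj₂ (proj₂ (Adj⇒Joins ab))
      e-out : ¬ Within σ e
      e-out = a≁b ∘ Within-Joins {σ = σ} {e} e-ab
      e-in : Within merged e
      e-in = Joins-Within {σ = merged} {e} e-ab merged-≡
      L = proj₁ tight
      sep = proj₁ (proj₂ (proj₂ tight))
      atb? : Decidable (λ v → σ v ≡ σ b)
      atb? v = σ v ≟ σ b
      L′ = filter (¬? ∘ atb?) L

      L′⊆ : All (_∈ V) L′
      L′⊆ = All.filter⁺ (¬? ∘ atb?) (proj₁ (proj₂ tight))

      at-most-one : ∀ {K} → Separated σ K → All (λ v → σ v ≡ σ b) K → length K ≤ 1
      at-most-one {[]} _ _ = z≤n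
      at-most-one {_ ∷ []} _ _ = s≤s z≤n
      at-most-one {_ ∷ _ ∷ _} ((x≢y ∷ _) ∷ _) (p ∷ q ∷ _) = contradiction (trans p (sym q)) x≢y

      L≤ : length L ≤ suc (length L′)
      L≤ = ≤-trans (≤-reflexive (sym (length-filter-¬ atb? L)))
        (+-monoˡ-≤ (length L′) (at-most-one (AllPairs.filter⁺ atb? sep) (All.all-filter atb? L)))

      merged-separated : ∀ {K} → Separated σ K → All (λ v → σ v ≢ σ b) K → Separated merged K
      merged-separated [] [] = []
      merged-separated (p ∷ ps) (q ∷ qs) =
        All.zipWith (λ (x≢y , y≢b) eq → x≢y (trans (sym (redirect-≢ (σ a) q)) (trans eq (redirect-≢ (σ a) y≢b)))) (p , qs)
        ∷ merged-separated ps qs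

      sep′ : Separated merged L′
      sep′ = merged-separated (AllPairs.filter⁺ (¬? ∘ atb?) sep) (All.all-filter (¬? ∘ atb?) L)

      crossing⊆ : ∀ {f} → ¬ Within merged f → ¬ Within σ f
      crossing⊆ ¬w w = ¬w (cong (redirect (σ a) (σ b)) w)

    -- Contracting an edge of a tree: at most one representative is lost, the one labelled `σ b`,
    -- and at least the edge joining `a` and `b` stops crossing.
    merged-tight : Tight V E merged
    merged-tight = L′ , L′⊆ , sep′ , ≤-pred (≤-trans (s≤s
      (length-filter-mono-< (¬? ∘ within? merged) (¬? ∘ within? σ) (λ {f} → crossing⊆ {f}) E e∈ e-out (λ ¬w → ¬w e-in)))
      (≤-trans (proj₂ (proj₂ (proj₂ tight))) L≤))

    -- A tree has no parallel edges: if a second edge stopped crossing, two crossing edges would go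
    -- for at most one class, and the merged labelling would violate connectedness.
    merged-Adj : ∀ {x y} → Adj E x y → ¬ (x ≡ a × y ≡ b) → ¬ (x ≡ b × y ≡ a) → merged x ≡ merged y → σ x ≡ σ y
    merged-Adj {x} {y} xy ≢ab ≢ba eq with Adj⇒Joins xy | σ x ≟ σ y
    ... | _ | yes x∼y = x∼y
    ... | f , f∈ , f-xy | no x≁y = contradiction
      (≤-trans (proj₂ (proj₂ (proj₂ tight))) (≤-trans L≤ (s≤s (conn merged L′⊆ sep′))))
      (<⇒≱ (s≤s (length-filter-mono-≪ (¬? ∘ within? merged) (¬? ∘ within? σ) (λ {f} → crossing⊆ {f}) E e∈ f∈ e≢f
        e-out (λ ¬w → ¬w e-in)
        (x≁y ∘ Within-Joins {σ = σ} {f} f-xy) (λ ¬w → ¬w (Joins-Within {σ = merged} {f} f-xy eq)))))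
      where
      e≢f : e ≢ f
      e≢f e≡f with Joins-unique {e = e} e-ab (subst (λ g → Joins g x y) (sym e≡f) f-xy)
      ... | inj₁ p = ≢ab p
      ... | inj₂ p = ≢ba p

  -- A triangle not inside a class would give a cycle in the tree of classes. Merge the classes of
  -- `a` and `b`. If `c` falls into the merged class, then `ac` and `bc` were not crossing before.
  -- Otherwise merge `b` and `c` as well: `ac` stops crossing along with `bc`, which a tree forbids.
  tight⇒triangle-constant : ∀ {σ a b c} → Tight V E σ → Triangle E (a , b , c) → σ a ≡ σ b
  tight⇒triangle-constant {σ} {a} {b} {c} tight (ab , bc , ac) with σ a ≟ σ b
  ... | yes p = p
  ... | no a≁b with merged {σ} tight ab a≁b b ≟ merged {σ} tight ab a≁b c
  ...   | yes eq = trans (old-Adj ac (c≢b ∘ proj₂) (a≢b ∘ proj₁) (trans (merged-≡ tight ab a≁b) eq))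
                         (sym (old-Adj bc (a≢b ∘ sym ∘ proj₁) (c≢a ∘ proj₂) eq))
    where
    old-Adj = merged-Adj tight ab a≁b
    a≢b = Adj⇒≢ ab
    c≢b = Adj⇒≢ bc ∘ sym
    c≢a = Adj⇒≢ ac ∘ sym
  ...   | no b≁c = contradiction
    (trans (sym (merged-≡ tight ab a≁b))
      (merged-Adj tight′ bc b≁c ac (Adj⇒≢ ab ∘ proj₁) (Adj⇒≢ ac ∘ proj₁)
        (trans (cong (redirect _ _) (merged-≡ tight ab a≁b)) (merged-≡ tight′ bc b≁c))))
    b≁c
    where
    tight′ = merged-tight tight ab a≁b

-- Both ends of an inner edge have the same label, so testing the source alone decides on which side
-- of the split the edge falls.
Ends-filter : ∀ {V : List (Fin n)} {E} (τ : Labelling n) {Q : ℕ → Set} (Q? : Decidable Q) →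
  All (Within τ) E → All (Ends V) E → All (Ends (filter (Q? ∘ τ) V)) (filter (Q? ∘ τ ∘ src) E)
Ends-filter {E = E} τ {Q} Q? within ends = All.tabulate λ e∈ →
  let (e∈E , q) = ∈-filter⁻ (Q? ∘ τ ∘ src) {xs = E} e∈
      (s∈ , d∈) = All.lookup ends e∈E
  in ∈-filter⁺ (Q? ∘ τ) s∈ q , ∈-filter⁺ (Q? ∘ τ) d∈ (subst Q (All.lookup within e∈E) q)

-- If τ separated u and v, then both of their τ-classes would fail to span a
-- triangle: a triangle of E is a σ-class, and that of u contains v.
few-crossings-agree : ∀ {V : List (Fin n)} {E r} → Unique V → Unique E → All (Ends V) E → Connected V E →
  3 * r < length V → length V + r ≤ suc (length E) →
  ∀ {σ τ u v} → Classes≤3 σ → Classes≤3 τ → crossing σ E ≤ r → crossing τ E ≤ r →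
  u ∈ V → v ∈ V → u ≢ v → σ u ≡ σ v → τ u ≡ τ v
few-crossings-agree {n = n} {V} {E} {r} uV uE ends conn 3r<V V+r≤E {σ} {τ} {u} {v} σ≤3 τ≤3 σ-few τ-few u∈ v∈ u≢v u∼v
  with τ u ≟ τ v
... | yes p = p
... | no u≁v = contradiction V≤F (<⇒≱ F<V)
  where
  -- More than `3 * r` vertices need more than `r` classes of size three, while at most `r` edges
  -- cross.
  σ-tight : Tight V E σ
  σ-tight =
    let (L , L⊆ , sep , V≤3L) = representatives σ≤3 (length V) V ≤-refl uV
    in L , L⊆ , sep , ≤-trans (s≤s σ-few) (*-cancelˡ-< 3 r (length L) (≤-trans 3r<V V≤3L))

  F = inner τ E
  uF : Unique F
  uF = Unique.filter⁺ (within? τ) uE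
  F-within : All (Within τ) F
  F-within = All.all-filter (within? τ) E
  F-ends : All (Ends V) F
  F-ends = All.filter⁺ (within? τ) ends

  -- Of at least `length V + r - 1` edges at most `r` cross `τ`, so the inner ones are at most one
  -- short of saturation.
  V≤F : length V ≤ suc (length F)
  V≤F = +-cancelʳ-≤ r _ _ (≤-trans V+r≤E (s≤s
    (≤-trans (≤-reflexive (sym (inner+crossing τ E))) (+-monoʳ-≤ (length F) τ-few))))

  no-triangle : ∀ {x y} → x ≢ y → σ x ≡ σ y → τ x ≢ τ y → ∀ {p q} → ¬ Triangle F (x , p , q)
  no-triangle x≢y x∼y x≁y {p} {q} (xp , pq , xq) =
    no-four σ≤3 (Adj⇒≢ xp) (Adj⇒≢ xq) x≢y (Adj⇒≢ pq)
      (λ { refl → x≁y (Adj-Within F-within xp) }) (λ { refl → x≁y (Adj-Within F-within xq) })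
      (sym x≡p) (sym (trans x≡p p≡q)) (sym x∼y)
    where
    up : ∀ {a b} → Adj F a b → Adj E a b
    up = Adj-mono (proj₁ ∘ ∈-filter⁻ (within? τ))
    x≡p = tight⇒triangle-constant conn σ-tight (up xp , up pq , up xq)
    p≡q = tight⇒triangle-constant conn σ-tight (up pq , up (Adj-sym xq) , up (Adj-sym xp))

  -- A part with as many inner edges as vertices would contain a triangle through `x`.
  deficient : ∀ {x y} → x ≢ y → σ x ≡ σ y → τ x ≢ τ y →
    ∀ {V′ F′} → Unique V′ → Unique F′ → All (Ends V′) F′ → (∀ {e} → e ∈ F′ → e ∈ F) → x ∈ V′ →
    length F′ < length V′
  deficient x≢y x∼y x≁y {V′} {F′} uV′ uF′ ends′ F′⊆F x∈ = ≰⇒> λ V′≤F′ →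
    let (_ , _ , xp , pq , xq) = saturated⇒triangle uV′ uF′ ends′
          (All.tabulate (All.lookup F-within ∘ F′⊆F)) τ≤3 V′≤F′ x∈
    in no-triangle x≢y x∼y x≁y (Adj-mono F′⊆F xp , Adj-mono F′⊆F pq , Adj-mono F′⊆F xq)

  atu? : Decidable (_≡ τ u)
  atu? = _≟ τ u
  atv? : Decidable (_≡ τ v)
  atv? = _≟ τ v

  -- The class of `u`, the class of `v` and the remainder: each of the two classes is at least one
  -- edge short and the remainder has no surplus, so `F` is two short.
  V₁ = filter (atu? ∘ τ) V
  V₀ = filter (¬? ∘ atu? ∘ τ) V
  V₂ = filter (atv? ∘ τ) V₀
  V₃ = filter (¬? ∘ atv? ∘ τ) V₀
  F₁ = filter (atu? ∘ τ ∘ src) F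
  F₀ = filter (¬? ∘ atu? ∘ τ ∘ src) F
  F₂ = filter (atv? ∘ τ ∘ src) F₀
  F₃ = filter (¬? ∘ atv? ∘ τ ∘ src) F₀

  uV₀ : Unique V₀
  uV₀ = Unique.filter⁺ (¬? ∘ atu? ∘ τ) uV
  uF₀ : Unique F₀
  uF₀ = Unique.filter⁺ (¬? ∘ atu? ∘ τ ∘ src) uF
  F₀-within : All (Within τ) F₀
  F₀-within = All.filter⁺ (¬? ∘ atu? ∘ τ ∘ src) F-within
  F₀-ends : All (Ends V₀) F₀
  F₀-ends = Ends-filter τ (¬? ∘ atu?) F-within F-ends

  F₁<V₁ : length F₁ < length V₁
  F₁<V₁ = deficient u≢v u∼v u≁v (Unique.filter⁺ (atu? ∘ τ) uV) (Unique.filter⁺ (atu? ∘ τ ∘ src) uF)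
    (Ends-filter τ atu? F-within F-ends) (proj₁ ∘ ∈-filter⁻ (atu? ∘ τ ∘ src)) (∈-filter⁺ (atu? ∘ τ) u∈ refl)

  F₂<V₂ : length F₂ < length V₂
  F₂<V₂ = deficient (u≢v ∘ sym) (sym u∼v) (u≁v ∘ sym)
    (Unique.filter⁺ (atv? ∘ τ) uV₀) (Unique.filter⁺ (atv? ∘ τ ∘ src) uF₀)
    (Ends-filter τ atv? F₀-within F₀-ends)
    (proj₁ ∘ ∈-filter⁻ (¬? ∘ atu? ∘ τ ∘ src) ∘ proj₁ ∘ ∈-filter⁻ (atv? ∘ τ ∘ src) {xs = F₀})
    (∈-filter⁺ (atv? ∘ τ) (∈-filter⁺ (¬? ∘ atu? ∘ τ) v∈ (u≁v ∘ sym)) refl)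

  F₃≤V₃ : length F₃ ≤ length V₃
  F₃≤V₃ = within⇒edges≤vertices (Unique.filter⁺ (¬? ∘ atv? ∘ τ) uV₀) (Unique.filter⁺ (¬? ∘ atv? ∘ τ ∘ src) uF₀)
    (Ends-filter τ (¬? ∘ atv?) F₀-within F₀-ends) (All.filter⁺ (¬? ∘ atv? ∘ τ ∘ src) F₀-within) τ≤3

  F<V : suc (suc (length F)) ≤ length V
  F<V = begin
    suc (suc (length F))
      ≡⟨ cong (suc ∘ suc) (sym (trans (cong (length F₁ +_) (length-filter-¬ (atv? ∘ τ ∘ src) F₀))
                                      (length-filter-¬ (atu? ∘ τ ∘ src) F))) ⟩
    suc (suc (length F₁ + (length F₂ + length F₃)))
      ≡⟨ sym (+-suc (suc (length F₁)) _) ⟩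
    suc (length F₁) + (suc (length F₂) + length F₃)
      ≤⟨ +-mono-≤ F₁<V₁ (+-mono-≤ F₂<V₂ F₃≤V₃) ⟩
    length V₁ + (length V₂ + length V₃)
      ≡⟨ trans (cong (length V₁ +_) (length-filter-¬ (atv? ∘ τ) V₀)) (length-filter-¬ (atu? ∘ τ) V) ⟩
    length V ∎
    where open ≤-Reasoning

-- With as many inner edges as vertices, `src e` would lie in a triangle of inner edges. That
-- triangle fills its class, which contains `dst e`, so `e` would lie in a triangle; a bridge does
-- not.
bridge-unsaturated : ∀ {V W : List (Fin n)} {E F e σ} → Unique (V ++ W) → (∀ {x} → x ∈ V → x ∈ W → ⊥) →
  Unique (e ∷ (E ++ F)) → All (Ends V) E → All (Ends W) F → src e ∈ V → dst e ∈ W →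
  Classes≤3 σ → Within σ e → length (inner σ (e ∷ (E ++ F))) < length (V ++ W)
bridge-unsaturated {V = V} {W} {E} {F} {e} {σ} uVW disj uG endsE endsF s∈ d∈ σ≤3 w = ≰⇒> impossible
  where
  G = e ∷ (E ++ F)
  G-ends : All (Ends (V ++ W)) G
  G-ends = (∈-++⁺ˡ s∈ , ∈-++⁺ʳ V d∈) ∷ All.++⁺ (All.map (λ (a , b) → ∈-++⁺ˡ a , ∈-++⁺ˡ b) endsE)
                                               (All.map (λ (a , b) → ∈-++⁺ʳ V a , ∈-++⁺ʳ V b) endsF)
  I-within : All (Within σ) (inner σ G)
  I-within = All.all-filter (within? σ) G
  up : ∀ {a b} → Adj (inner σ G) a b → Adj G a b
  up = Adj-mono (proj₁ ∘ ∈-filter⁻ (within? σ))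
  side : ∀ {x y} → Adj G x y → ¬ Joins e x y → Adj (E ++ F) x y
  side (inj₁ (_ , here refl)) ¬j = contradiction (inj₁ (refl , refl)) ¬j
  side (inj₂ (_ , here refl)) ¬j = contradiction (inj₂ (refl , refl)) ¬j
  side (inj₁ (p , there f∈)) _ = inj₁ (p , f∈)
  side (inj₂ (p , there f∈)) _ = inj₂ (p , f∈)
  split : ∀ {x y} → Adj (E ++ F) x y → Adj E x y ⊎ Adj F x y
  split (inj₁ (p , f∈)) with ∈-++⁻ E f∈
  ... | inj₁ f∈E = inj₁ (inj₁ (p , f∈E))
  ... | inj₂ f∈F = inj₂ (inj₁ (p , f∈F))
  split (inj₂ (p , f∈)) with ∈-++⁻ E f∈
  ... | inj₁ f∈E = inj₁ (inj₂ (p , f∈E))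
  ... | inj₂ f∈F = inj₂ (inj₂ (p , f∈F))
  -- Apart from `e`, edges at `src e` stay in `V` and edges at `dst e` stay in `W`.
  no-common-nbr : ∀ {z} → Adj G (src e) z → Adj G (dst e) z → ⊥
  no-common-nbr {z} sz dz
    with split (side sz (λ { (inj₁ (_ , refl)) → Adj⇒≢ dz refl ; (inj₂ (p , _)) → src≢dst e p }))
       | split (side dz (λ { (inj₁ (p , _)) → src≢dst e (sym p) ; (inj₂ (_ , refl)) → Adj⇒≢ sz refl }))
  ... | inj₂ szF | _ = disj s∈ (proj₁ (Adj-Ends endsF szF))
  ... | inj₁ _ | inj₁ dzE = disj (proj₁ (Adj-Ends endsE dzE)) d∈
  ... | inj₁ szE | inj₂ dzF = disj (proj₂ (Adj-Ends endsE szE)) (proj₂ (Adj-Ends endsF dzF))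
  impossible : ¬ length (V ++ W) ≤ length (inner σ G)
  impossible VW≤I with saturated⇒triangle uVW (Unique.filter⁺ (within? σ) uG) (All.filter⁺ (within? σ) G-ends)
                         I-within σ≤3 VW≤I (∈-++⁺ˡ s∈)
  ... | p , q , sp , pq , sq with dst e Fin.≟ p | dst e Fin.≟ q
  ...   | yes refl | _ = no-common-nbr (up sq) (up pq)
  ...   | no _ | yes refl = no-common-nbr (up sp) (up (Adj-sym pq))
  ...   | no d≢p | no d≢q = no-four σ≤3 (Adj⇒≢ sp) (Adj⇒≢ sq) (src≢dst e) (Adj⇒≢ pq) (d≢p ∘ sym) (d≢q ∘ sym)
            (sym (Adj-Within I-within sp)) (sym (Adj-Within I-within sq)) (sym w)

-- Permutations and disjointness

Unique-resp-↭ : {xs ys : List A} → xs ↭ ys → Unique xs → Unique ys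
Unique-resp-↭ {A = A} p = SetoidPerm.Unique-resp-↭ (setoid A) (↭⇒↭ₛ p)

Unique-++⁻ : ∀ (xs : List A) {ys} → Unique (xs ++ ys) →
  Unique xs × Unique ys × (∀ {x} → x ∈ xs → x ∈ ys → ⊥)
Unique-++⁻ [] u = [] , u , λ ()
Unique-++⁻ (x ∷ xs) (x∉ ∷ u) with Unique-++⁻ xs u
... | uxs , uys , disj = All.++⁻ˡ xs x∉ ∷ uxs , uys
  , λ { (here refl) y∈ → All.lookup (All.++⁻ʳ xs x∉) y∈ refl ; (there z∈) y∈ → disj z∈ y∈ }

concatMap-↭ : ∀ {B : Set} (f : A → List B) {xs ys} → xs ↭ ys → concatMap f xs ↭ concatMap f ys
concatMap-↭ f Perm.refl = ↭-refl
concatMap-↭ f (prep x p) = ++⁺ˡ (f x) (concatMap-↭ f p)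
concatMap-↭ f (swap x y p) = ↭-trans (shifts (f x) (f y)) (++⁺ˡ (f y) (++⁺ˡ (f x) (concatMap-↭ f p)))
concatMap-↭ f (Perm.trans p q) = ↭-trans (concatMap-↭ f p) (concatMap-↭ f q)

∈⇒↭ : ∀ {x : A} {xs} → x ∈ xs → ∃ λ ys → xs ↭ x ∷ ys
∈⇒↭ {x = x} x∈ with ∈-∃++ x∈
... | ys , zs , refl = ys ++ zs , shift x ys zs

Unique-⊆⇒length≤ : ∀ {xs ys : List A} → Unique xs → All (_∈ ys) xs → length xs ≤ length ys
Unique-⊆⇒length≤ [] [] = z≤n
Unique-⊆⇒length≤ {xs = x ∷ xs} (x∉ ∷ u) (x∈ ∷ xs⊆) with ∈⇒↭ x∈
... | zs , p = ≤-trans (s≤s (Unique-⊆⇒length≤ u (All.zipWith drop (x∉ , xs⊆)))) (≤-reflexive (sym (↭-length p)))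
  where
  drop : ∀ {y} → x ≢ y × y ∈ _ → y ∈ zs
  drop (x≢y , y∈) with ∈-resp-↭ p y∈
  ... | here refl = contradiction refl x≢y
  ... | there y∈zs = y∈zs

-- The labelling of a triangle factor

module _ {n : ℕ} where
  open import Data.List.Membership.DecPropositional (Fin._≟_ {n}) using (_∈?_)

  -- The position of the first triangle of `T` that contains `v`, or the length of `T` if there is
  -- none.
  label : List (Fin n × Fin n × Fin n) → Labelling n
  label [] v = 0
  label (t ∷ T) v with v ∈? vertsOf t
  ... | yes _ = 0
  ... | no _  = suc (label T v)

  label-here : ∀ {t T v} → v ∈ vertsOf t → label (t ∷ T) v ≡ 0
  label-here {t} {T} {v} v∈ with v ∈? vertsOf t
  ... | yes _ = refl
  ... | no v∉ = contradiction v∈ v∉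

  label-there : ∀ {t T v} → v ∉ vertsOf t → label (t ∷ T) v ≡ suc (label T v)
  label-there {t} {T} {v} v∉ with v ∈? vertsOf t
  ... | yes v∈ = contradiction v∈ v∉
  ... | no _ = refl

  -- Since the triangles are disjoint, the first one containing a vertex is the only one, so label
  -- classes are exactly the vertex sets of triangles.
  label-class : ∀ T {x} → Unique (concatMap vertsOf T) → x ∈ concatMap vertsOf T →
    ∃ λ t → t ∈ T × x ∈ vertsOf t
      × (∀ {y} → y ∈ concatMap vertsOf T → label T y ≡ label T x → y ∈ vertsOf t)
      × (∀ {y} → y ∈ vertsOf t → y ∈ concatMap vertsOf T × label T y ≡ label T x)
  label-class (t ∷ T) {x} uT x∈T with x ∈? vertsOf t
  ... | yes x∈t = t , here refl , x∈t , back , λ y∈ → ∈-++⁺ˡ y∈ , label-here {t} {T} y∈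
    where
    back : ∀ {y} → y ∈ concatMap vertsOf (t ∷ T) → label (t ∷ T) y ≡ 0 → y ∈ vertsOf t
    back {y} _ eq with y ∈? vertsOf t
    ... | yes y∈ = y∈
    back {y} _ () | no _
  ... | no x∉t with ∈-++⁻ (vertsOf t) x∈T
  ...   | inj₁ x∈t = contradiction x∈t x∉t
  ...   | inj₂ x∈ with Unique-++⁻ (vertsOf t) uT
  ...     | _ , uT′ , disj with label-class T uT′ x∈
  ...       | t′ , t′∈ , x∈t′ , back , forth = t′ , there t′∈ , x∈t′ , back′ , forth′
    where
    back′ : ∀ {y} → y ∈ concatMap vertsOf (t ∷ T) → label (t ∷ T) y ≡ suc (label T x) → y ∈ vertsOf t′
    back′ {y} y∈ eq with y ∈? vertsOf t | ∈-++⁻ (vertsOf t) y∈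
    back′ {y} y∈ () | yes _ | _
    ... | no y∉t | inj₁ y∈t = contradiction y∈t y∉t
    ... | no _ | inj₂ y∈T = back y∈T (suc-injective eq)
    forth′ : ∀ {y} → y ∈ vertsOf t′ → y ∈ concatMap vertsOf (t ∷ T) × label (t ∷ T) y ≡ suc (label T x)
    forth′ y∈ with forth y∈
    ... | y∈T , eq = ∈-++⁺ʳ (vertsOf t) y∈T , trans (label-there {t} {T} (λ y∈t → disj y∈t y∈T)) (cong suc eq)

triangle-Adj : ∀ {G : List (Edge n)} {t u v} → Triangle G t → u ∈ vertsOf t → v ∈ vertsOf t → u ≢ v → Adj G u v
triangle-Adj _ (here refl) (here refl) u≢v = contradiction refl u≢v
triangle-Adj (ab , _ , _) (here refl) (there (here refl)) _ = ab
triangle-Adj (_ , _ , ac) (here refl) (there (there (here refl))) _ = ac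
triangle-Adj (ab , _ , _) (there (here refl)) (here refl) _ = Adj-sym ab
triangle-Adj _ (there (here refl)) (there (here refl)) u≢v = contradiction refl u≢v
triangle-Adj (_ , bc , _) (there (here refl)) (there (there (here refl))) _ = bc
triangle-Adj (_ , _ , ac) (there (there (here refl))) (here refl) _ = Adj-sym ac
triangle-Adj (_ , bc , _) (there (there (here refl))) (there (here refl)) _ = Adj-sym bc
triangle-Adj _ (there (there (here refl))) (there (there (here refl))) u≢v = contradiction refl u≢v

triangle-partners : ∀ {G : List (Edge n)} {t u} → Triangle G t → u ∈ vertsOf t →
  ∃₂ λ p q → p ∈ vertsOf t × q ∈ vertsOf t × p ≢ q × u ≢ p × u ≢ q
triangle-partners {t = a , b , c} (ab , bc , ac) (here refl) =
  b , c , there (here refl) , there (there (here refl)) , Adj⇒≢ bc , Adj⇒≢ ab , Adj⇒≢ ac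
triangle-partners {t = a , b , c} (ab , bc , ac) (there (here refl)) =
  a , c , here refl , there (there (here refl)) , Adj⇒≢ ac , Adj⇒≢ ab ∘ sym , Adj⇒≢ bc
triangle-partners {t = a , b , c} (ab , bc , ac) (there (there (here refl))) =
  a , b , here refl , there (here refl) , Adj⇒≢ ab , Adj⇒≢ ac ∘ sym , Adj⇒≢ bc ∘ sym

-- A factor without its list of triangles: classes of exactly three vertices (`classes` from above,
-- `partners` from below), each a clique of `G`.
record FactorLabelling (G : List (Edge n)) : Set where
  field
    σ        : Labelling n
    classes  : Classes≤3 σ
    adjacent : ∀ {u v} → u ≢ v → σ u ≡ σ v → Adj G u v
    partners : ∀ v → ∃₂ λ p q → p ≢ q × v ≢ p × v ≢ q × σ v ≡ σ p × σ v ≡ σ q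

factor-labelling : ∀ {G : List (Edge n)} → HasK3Factor G → FactorLabelling G
factor-labelling {n} {G} (T , triangles , T↭) = record
  { σ = label T ; classes = classes ; adjacent = adjacent ; partners = partners }
  where
  uT : Unique (concatMap vertsOf T)
  uT = Unique-resp-↭ (↭-sym T↭) (Unique.allFin⁺ n)
  covered : ∀ v → v ∈ concatMap vertsOf T
  covered v = ∈-resp-↭ (↭-sym T↭) (∈-allFin v)
  classes : Classes≤3 (label T)
  classes {[]} _ _ _ = z≤n
  classes {x ∷ L} ℓ uL (px ∷ ps) with label-class T uT (covered x)
  ... | t , _ , x∈ , back , _ =
    Unique-⊆⇒length≤ {ys = vertsOf t} uL (x∈ ∷ All.map (λ {y} py → back (covered y) (trans py (sym px))) ps)
  adjacent : ∀ {u v} → u ≢ v → label T u ≡ label T v → Adj G u v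
  adjacent {u} {v} u≢v eq with label-class T uT (covered u)
  ... | t , t∈ , u∈ , back , _ = triangle-Adj (All.lookup triangles t∈) u∈ (back (covered v) (sym eq)) u≢v
  partners : ∀ v → ∃₂ λ p q → p ≢ q × v ≢ p × v ≢ q × label T v ≡ label T p × label T v ≡ label T q
  partners v with label-class T uT (covered v)
  ... | t , t∈ , v∈ , _ , forth with triangle-partners (All.lookup triangles t∈) v∈
  ...   | p , q , p∈ , q∈ , p≢q , v≢p , v≢q = p , q , p≢q , v≢p , v≢q , sym (proj₂ (forth p∈)) , sym (proj₂ (forth q∈))

-- Components of Client's graph

-- A component of Client's graph; waste is the number r of the introduction, and debt
-- is positive if the component is cheap.
record Block (n : ℕ) : Set where
  constructor block
  field
    verts : List (Fin n)
    edges : List (Edge n)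
    waste : ℕ
    debt  : ℕ
open Block

-- Here `H` is Waiter's graph. A factor triangle consists of Client's edges, so no edge of `H` may
-- lie within a class.
Possible : List (Edge n) → Labelling n → Set
Possible H σ = Classes≤3 σ × All (λ e → ¬ Within σ e) H

-- For 3K vertices: r < K, there are edges enough for K triangles and r wasted edges, and some
-- labelling still open wastes at most r. The last two conditions leave at least `length V` inner
-- edges, the most that classes of size three allow.
Cheap : List (Edge n) → Block n → Set
Cheap H (block V E r _) = 3 * r < length V × length V + r ≤ length E
  × ∃ λ σ → Possible H σ × crossing σ E ≤ r

record Sound (H : List (Edge n)) (B : Block n) : Set where
  field
    ends      : All (Ends (verts B)) (edges B)
    connected : Connected (verts B) (edges B)
    wasted    : ∀ {σ} → Possible H σ → waste B ≤ crossing σ (edges B)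
    indebted  : Cheap H B → 1 ≤ debt B
open Sound

-- More edges of Waiter leave fewer possible labellings: lower bounds on waste persist, and no block
-- becomes cheap.
Sound-∷ : ∀ {H : List (Edge n)} {B} f → Sound H B → Sound (f ∷ H) B
Sound-∷ f s = record
  { ends = ends s ; connected = connected s
  ; wasted = λ { (σ≤3 , _ ∷ h) → wasted s (σ≤3 , h) }
  ; indebted = λ { (a , b , σ , (σ≤3 , _ ∷ h) , c) → indebted s (a , b , σ , (σ≤3 , h) , c) } }

_⊕_ : Block n → Edge n → Block n
block V E r d ⊕ e = block V (e ∷ E) r d

⊕-sound : ∀ {H : List (Edge n)} {B e} d → Sound H B → Ends (verts B) e →
  (Cheap H (B ⊕ e) → 1 ≤ d) → Sound H (record (B ⊕ e) { debt = d })
⊕-sound {e = e} d s e-ends h = record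
  { ends = e-ends ∷ ends s ; connected = ∷-connected e (connected s)
  ; wasted = λ {σ} pσ → ≤-trans (wasted s pσ) (crossing-∷ σ e _)
  ; indebted = h }

-- The edge `e` adds nothing to the waste, since later edges may complete a factor triangle through
-- it.
bridge : Block n → Edge n → Block n → Block n
bridge (block V E r d) e (block W F r′ d′) = block (V ++ W) (e ∷ (E ++ F)) (r + r′) (d + d′)

-- At least `waste B` old edges cross already, so a crossing `e` would exceed the allowance.
⊕-cheap : ∀ {H : List (Edge n)} {B e} → Sound H B → Cheap H (B ⊕ e) →
  ∃ λ σ → Possible H σ × Within σ e × crossing σ (edges B) ≤ waste B
⊕-cheap {B = B} {e} s (_ , _ , σ , pσ , few) with within? σ e
... | yes w = σ , pσ , w , ≤-trans (crossing-∷ σ e (edges B)) few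
... | no ¬w = contradiction (≤-trans (≤-reflexive (sym (crossing-∷-¬within {σ = σ} {e} (edges B) ¬w))) few)
                            (<⇒≱ (s≤s (wasted s pσ)))

-- The invariant and the moves of Client that preserve it

record Proper (P : Position n) : Set where
  field
    unique   : Unique (client P)
    disjoint : ∀ {e} → e ∈ client P → e ∈ waiter P → ⊥

Proper-offer : ∀ {P : Position n} {e f} → e ≢ f → Free P e → Free P f → Proper P →
  Proper (pos (e ∷ client P) (f ∷ waiter P))
Proper-offer e≢f (e∉c , e∉w) (f∉c , _) p = record
  { unique = All.tabulate (λ { x∈ refl → e∉c x∈ }) ∷ Proper.unique p
  ; disjoint = λ { (here refl) (here refl) → e≢f refl ; (here refl) (there x∈w) → e∉w x∈w
                 ; (there x∈c) (here refl) → f∉c x∈c ; (there x∈c) (there x∈w) → Proper.disjoint p x∈c x∈w } }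

record Invariant (P : Position n) (Bs : List (Block n)) : Set where
  field
    proper  : Proper P
    sound   : All (Sound (waiter P)) Bs
    verts↭  : concatMap verts Bs ↭ allFin n
    edges↭  : concatMap edges Bs ↭ client P
    balance : sum (map debt Bs) ≤ sum (map waste Bs)
open Invariant

Invariant-↭ : ∀ {P : Position n} {Bs Cs} → Bs ↭ Cs → Invariant P Bs → Invariant P Cs
Invariant-↭ p I = record
  { proper = proper I
  ; sound = All-resp-↭ p (sound I)
  ; verts↭ = ↭-trans (↭-sym (concatMap-↭ verts p)) (verts↭ I)
  ; edges↭ = ↭-trans (↭-sym (concatMap-↭ edges p)) (edges↭ I)
  ; balance = subst₂ _≤_ (sum-↭ (map⁺ debt p)) (sum-↭ (map⁺ waste p)) (balance I) }

module _ {P : Position n} {B : Block n} {Bs : List (Block n)} (I : Invariant P (B ∷ Bs)) where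

  verts-unique : Unique (concatMap verts (B ∷ Bs))
  verts-unique = Unique-resp-↭ (↭-sym (verts↭ I)) (Unique.allFin⁺ n)

  edges-unique : Unique (concatMap edges (B ∷ Bs))
  edges-unique = Unique-resp-↭ (↭-sym (edges↭ I)) (Proper.unique (proper I))

  head-verts-unique : Unique (verts B)
  head-verts-unique = proj₁ (Unique-++⁻ (verts B) verts-unique)

  head-edges-unique : Unique (edges B)
  head-edges-unique = proj₁ (Unique-++⁻ (edges B) edges-unique)

  free⇒∉head : ∀ {e} → Free P e → e ∉ edges B
  free⇒∉head (e∉c , _) e∈ = e∉c (∈-resp-↭ (edges↭ I) (∈-++⁺ˡ e∈))

∉⇒Unique-∷ : ∀ {x : A} {xs} → x ∉ xs → Unique xs → Unique (x ∷ xs)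
∉⇒Unique-∷ x∉ u = All.tabulate (λ { y∈ refl → x∉ y∈ }) ∷ u

⊕-invariant : ∀ {P : Position n} {B Bs e f} → Invariant P (B ∷ Bs) → Ends (verts B) e →
  e ≢ f → Free P e → Free P f → ¬ Cheap (waiter P) (B ⊕ e) →
  Invariant (pos (e ∷ client P) (f ∷ waiter P)) (B ⊕ e ∷ Bs)
⊕-invariant {B = B} {e = e} {f} I e-ends e≢f e-free f-free ¬cheap with sound I
... | s ∷ ss = record
  { proper = Proper-offer e≢f e-free f-free (proper I)
  ; sound = All.map (Sound-∷ f) (⊕-sound (debt B) s e-ends (λ c → contradiction c ¬cheap) ∷ ss)
  ; verts↭ = verts↭ I
  ; edges↭ = prep e (edges↭ I)
  ; balance = balance I }

-- If `e` crosses, it comes on top of the waste of both sides. If not, cheapness would require as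
-- many inner edges as vertices, which a non-crossing bridge excludes. Joining two blocks therefore
-- incurs no debt.
bridge-not-cheap : ∀ {P : Position n} {B C Bs e} → Invariant P (B ∷ C ∷ Bs) → src e ∈ verts B → dst e ∈ verts C →
  Free P e → ¬ Cheap (waiter P) (bridge B e C)
bridge-not-cheap {P = P} {B} {C} {Bs} {e} I s∈ d∈ (e∉c , _) (_ , VW+r≤G , σ , pσ@(σ≤3 , _) , few) with sound I
... | sB ∷ sC ∷ _ with within? σ e
...   | no ¬w = contradiction (≤-trans (≤-reflexive (sym (crossing-∷-¬within {σ = σ} {e} (edges B ++ edges C) ¬w))) few)
    (<⇒≱ (s≤s (≤-trans (+-mono-≤ (wasted sB pσ) (wasted sC pσ)) (≤-reflexive (sym (crossing-++ σ (edges B) (edges C)))))))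
...   | yes w = contradiction VW≤ (<⇒≱ (bridge-unsaturated uVW (λ x∈ y∈ → proj₂ (proj₂ (Unique-++⁻ (verts B) uVW)) x∈ y∈)
      (∉⇒Unique-∷ e∉ uEF) (ends sB) (ends sC) s∈ d∈ σ≤3 w))
  where
  front : ∀ {X : Set} (f : Block _ → List X) → Unique (concatMap f (B ∷ C ∷ Bs)) → Unique (f B ++ f C)
  front f u = proj₁ (Unique-++⁻ (f B ++ f C) (subst Unique (sym (++-assoc (f B) (f C) _)) u))
  uVW = front verts (verts-unique I)
  uEF = front edges (edges-unique I)
  e∉ : e ∉ edges B ++ edges C
  e∉ e∈ = e∉c (∈-resp-↭ (edges↭ I) (subst (e ∈_) (++-assoc (edges B) (edges C) _) (∈-++⁺ˡ e∈)))
  G = e ∷ (edges B ++ edges C)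
  VW≤ : length (verts B ++ verts C) ≤ length (inner σ G)
  VW≤ = +-cancelʳ-≤ (waste B + waste C) _ _ (≤-trans VW+r≤G
    (≤-trans (≤-reflexive (sym (inner+crossing σ G))) (+-monoʳ-≤ (length (inner σ G)) few)))

bridge-invariant : ∀ {P : Position n} {B C Bs e f} → Invariant P (B ∷ C ∷ Bs) → src e ∈ verts B → dst e ∈ verts C →
  e ≢ f → Free P e → Free P f → Invariant (pos (e ∷ client P) (f ∷ waiter P)) (bridge B e C ∷ Bs)
bridge-invariant {B = B} {C} {Bs} {e} {f} I s∈ d∈ e≢f e-free f-free with sound I
... | sB ∷ sC ∷ ss = record
  { proper = Proper-offer e≢f e-free f-free (proper I)
  ; sound = All.map (Sound-∷ f) (record
      { ends = (∈-++⁺ˡ s∈ , ∈-++⁺ʳ (verts B) d∈)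
          ∷ All.++⁺ (All.map (λ (a , b) → ∈-++⁺ˡ a , ∈-++⁺ˡ b) (ends sB))
                    (All.map (λ (a , b) → ∈-++⁺ʳ (verts B) a , ∈-++⁺ʳ (verts B) b) (ends sC))
      ; connected = bridge-connected {E = edges B} {edges C} e s∈ d∈ (connected sB) (connected sC)
      ; wasted = λ {σ} pσ → ≤-trans (+-mono-≤ (wasted sB pσ) (wasted sC pσ))
          (≤-trans (≤-reflexive (sym (crossing-++ σ (edges B) (edges C)))) (crossing-∷ σ e (edges B ++ edges C)))
      ; indebted = λ c → contradiction c (bridge-not-cheap I s∈ d∈ e-free) } ∷ ss)
  ; verts↭ = subst (_↭ allFin _) (sym (++-assoc (verts B) (verts C) _)) (verts↭ I)
  ; edges↭ = prep e (subst (_↭ _) (sym (++-assoc (edges B) (edges C) _)) (edges↭ I))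
  ; balance = subst₂ _≤_ (sym (+-assoc (debt B) (debt C) _)) (sym (+-assoc (waste B) (waste C) _)) (balance I) }

-- The labelling `τ` that makes `e` cheap agrees with `σ`, so `f` is inner for it too. But `τ` is at
-- most one inner edge short of saturation and has no room for both `e` and `f`.
⊕-cheap-unique : ∀ {P : Position n} {B Bs e f} → Invariant P (B ∷ Bs) → e ≢ f → Free P e → Free P f →
  Ends (verts B) e → Ends (verts B) f → Cheap (waiter P) (B ⊕ e) → Cheap (waiter P) (B ⊕ f) → ⊥
⊕-cheap-unique {B = B} {e = e} {f} I e≢f e-free f-free e-ends f-ends cheap-e@(3r<V , V+r≤E , _) cheap-f
  with sound I
... | s ∷ _ with ⊕-cheap s cheap-e | ⊕-cheap s cheap-f
...   | τ , (τ≤3 , _) , e-in , τ-few | σ , (σ≤3 , _) , f-in , σ-few = contradiction V≤ (<⇒≱ <V)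
  where
  E = edges B
  f∈τ : Within τ f
  f∈τ = few-crossings-agree (head-verts-unique I) (head-edges-unique I) (ends s) (connected s) 3r<V V+r≤E
    σ≤3 τ≤3 σ-few τ-few (proj₁ f-ends) (proj₂ f-ends) (src≢dst f) f-in
  e∉ : e ∉ inner τ E
  e∉ = free⇒∉head I e-free ∘ proj₁ ∘ ∈-filter⁻ (within? τ)
  f∉ : f ∉ e ∷ inner τ E
  f∉ (here f≡e) = e≢f (sym f≡e)
  f∉ (there f∈) = free⇒∉head I f-free (proj₁ (∈-filter⁻ (within? τ) f∈))
  <V : suc (suc (length (inner τ E))) ≤ length (verts B)
  <V = within⇒edges≤vertices (head-verts-unique I)
    (∉⇒Unique-∷ f∉ (∉⇒Unique-∷ e∉ (Unique.filter⁺ (within? τ) (head-edges-unique I))))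
    (f-ends ∷ e-ends ∷ All.filter⁺ (within? τ) (ends s)) (f∈τ ∷ e-in ∷ All.all-filter (within? τ) E) τ≤3
  V≤ : length (verts B) ≤ suc (length (inner τ E))
  V≤ = +-cancelʳ-≤ (waste B) _ _ (≤-trans V+r≤E (s≤s
    (≤-trans (≤-reflexive (sym (inner+crossing τ E))) (+-monoʳ-≤ (length (inner τ E)) τ-few))))

-- Completing B ⊕ e forces a further wasted edge in C, since f was the only edge
-- that could complete C without one.
exchange-invariant : ∀ {P : Position n} {B C Bs e f} → Invariant P (B ∷ C ∷ Bs) →
  e ≢ f → Free P e → Free P f → Ends (verts B) e → Ends (verts C) f → Cheap (waiter P) (C ⊕ f) →
  Invariant (pos (e ∷ client P) (f ∷ waiter P))
    (record (B ⊕ e) { debt = suc (debt B) } ∷ record C { waste = suc (waste C) } ∷ Bs)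
exchange-invariant {P = P} {B} {C} {Bs} {e} {f} I e≢f e-free f-free e-ends f-ends cheap@(3r<V , V+r≤E , _) with sound I
... | sB ∷ sC ∷ ss with ⊕-cheap sC cheap
...   | σ , (σ≤3 , _) , f-in , σ-few = record
  { proper = Proper-offer e≢f e-free f-free (proper I)
  ; sound = Sound-∷ f (⊕-sound (suc (debt B)) sB e-ends (λ _ → s≤s z≤n)) ∷ (record
      { ends = ends sC
      ; connected = connected sC
      -- A labelling with no more crossings than the old waste would agree with `σ` on the ends of
      -- `f`, which now belongs to Waiter.
      ; wasted = λ { {τ} (τ≤3 , ¬f ∷ _) → ≰⇒> λ τ-few → ¬f
          (few-crossings-agree uV uE (ends sC) (connected sC) 3r<V V+r≤E σ≤3 τ≤3 σ-few τ-few
            (proj₁ f-ends) (proj₂ f-ends) (src≢dst f) f-in) }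
      -- With the waste raised by one, cheapness would need more than `length V + r` edges, but `σ`
      -- shows that there are no more than that.
      ; indebted = λ { (_ , V+r<E , _) → contradiction
          (≤-trans (≤-reflexive (sym (+-suc (length (verts C)) (waste C)))) V+r<E) (<⇒≱ (s≤s E≤V+r)) } })
      ∷ All.map (Sound-∷ f) ss
  ; verts↭ = verts↭ I
  ; edges↭ = prep e (edges↭ I)
  ; balance = ≤-trans (s≤s (balance I)) (≤-reflexive (sym (+-suc (waste B) _))) }
  where
  I′ : Invariant P (C ∷ B ∷ Bs)
  I′ = Invariant-↭ (swap B C ↭-refl) I
  uV = head-verts-unique I′
  uE = head-edges-unique I′
  E≤V+r : length (edges C) ≤ length (verts C) + waste C
  E≤V+r = ≤-trans (≤-reflexive (sym (inner+crossing σ (edges C))))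
    (+-mono-≤ (within⇒edges≤vertices uV (Unique.filter⁺ (within? σ) uE) (All.filter⁺ (within? σ) (ends sC))
                 (All.all-filter (within? σ) (edges C)) σ≤3) σ-few)

-- Client's reply

data Located (Bs : List (Block n)) (e : Edge n) : Set where
  inside  : ∀ B Cs → Bs ↭ B ∷ Cs → Ends (verts B) e → Located Bs e
  between : ∀ B C Cs → Bs ↭ B ∷ C ∷ Cs → src e ∈ verts B → dst e ∈ verts C → Located Bs e

focus : ∀ (Bs : List (Block n)) {v} → v ∈ concatMap verts Bs → ∃₂ λ B Cs → Bs ↭ B ∷ Cs × v ∈ verts B
focus (B ∷ Bs) v∈ with ∈-++⁻ (verts B) v∈
... | inj₁ v∈B = B , Bs , ↭-refl , v∈B
... | inj₂ v∈Bs with focus Bs v∈Bs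
...   | C , Cs , p , v∈C = C , B ∷ Cs , ↭-trans (prep B p) (swap B C ↭-refl) , v∈C

locate : ∀ (Bs : List (Block n)) e → Ends (concatMap verts Bs) e → Located Bs e
locate Bs e (s∈ , d∈) with focus Bs s∈
... | B , Cs , p , s∈B with ∈-++⁻ (verts B) (∈-resp-↭ (concatMap-↭ verts p) d∈)
...   | inj₁ d∈B = inside B Cs p (s∈B , d∈B)
...   | inj₂ d∈Cs with focus Cs d∈Cs
...     | C , Ds , q , d∈C = between B C Ds (↭-trans p (prep B q)) s∈B d∈C

-- Cheapness quantifies over labellings and is not decided here, so the case distinction on it is
-- made under a double negation.
client-reply : ∀ {P : Position n} {e f} → ∃ (Invariant P) → e ≢ f → Free P e → Free P f →
  ¬ ¬ (∃ (Invariant (pos (e ∷ client P) (f ∷ waiter P))) ⊎ ∃ (Invariant (pos (f ∷ client P) (e ∷ waiter P))))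
client-reply {n} {P} {e} {f} (Bs , I) e≢f e-free f-free k = reply (locate Bs e (covered I (src e) , covered I (dst e)))
  where
  covered : ∀ {Cs} → Invariant P Cs → ∀ v → v ∈ concatMap verts Cs
  covered J v = ∈-resp-↭ (↭-sym (verts↭ J)) (∈-allFin v)
  take-e : ∀ {Cs} → Invariant (pos (e ∷ client P) (f ∷ waiter P)) Cs → ⊥
  take-e J = k (inj₁ (_ , J))
  take-f : ∀ {Cs} → Invariant (pos (f ∷ client P) (e ∷ waiter P)) Cs → ⊥
  take-f J = k (inj₂ (_ , J))
  f≢e = e≢f ∘ sym
  f-between : ∀ {B C Cs} → Invariant P (B ∷ C ∷ Cs) → src f ∈ verts B → dst f ∈ verts C → ⊥
  f-between J s∈ d∈ = take-f (bridge-invariant J s∈ d∈ f≢e f-free e-free)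
  both : ∀ {B Cs} → Invariant P (B ∷ Cs) → Ends (verts B) e → Cheap (waiter P) (B ⊕ e) → ⊥
  both {B} {Cs} J e-ends cheap-e with ∈-++⁻ (verts B) (covered J (src f)) | ∈-++⁻ (verts B) (covered J (dst f))
  ... | inj₁ s∈B | inj₁ d∈B = take-f (⊕-invariant J (s∈B , d∈B) f≢e f-free e-free
          (⊕-cheap-unique J e≢f e-free f-free e-ends (s∈B , d∈B) cheap-e))
  ... | inj₁ s∈B | inj₂ d∈Cs with focus Cs d∈Cs
  ...   | C , Ds , p , d∈C = f-between (Invariant-↭ (prep B p) J) s∈B d∈C
  both {B} {Cs} J e-ends cheap-e | inj₂ s∈Cs | inj₁ d∈B with focus Cs s∈Cs
  ...   | C , Ds , p , s∈C = f-between (Invariant-↭ (↭-trans (prep B p) (swap B C ↭-refl)) J) s∈C d∈B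
  both {B} {Cs} J e-ends cheap-e | inj₂ s∈Cs | inj₂ d∈Cs with locate Cs f (s∈Cs , d∈Cs)
  ...   | between C D Ds p s∈C d∈D = f-between (Invariant-↭
            (↭-trans (prep B p) (↭-trans (swap B C ↭-refl) (prep C (swap B D ↭-refl)))) J) s∈C d∈D
  -- Client takes `f` unless this makes `C` cheap; then both replies would create a cheap block, and
  -- the debt from taking `e` is balanced by waste in `C`.
  ...   | inside C Ds p f-ends =
            take-f (⊕-invariant (Invariant-↭ (swap B C ↭-refl) J′) f-ends f≢e f-free e-free
              λ cheap-f → take-e (exchange-invariant J′ e≢f e-free f-free e-ends f-ends cheap-f))
    where
    J′ : Invariant P (B ∷ C ∷ Ds)
    J′ = Invariant-↭ (prep B p) J
  reply : Located Bs e → ⊥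
  reply (between B C Cs p s∈ d∈) = take-e (bridge-invariant (Invariant-↭ p I) s∈ d∈ e≢f e-free f-free)
  -- Taking `e` works unless `B ⊕ e` is cheap; `both` refutes that case by producing an invariant
  -- for one of the two replies.
  reply (inside B Cs p e-ends) = take-e (⊕-invariant J e-ends e≢f e-free f-free (both J e-ends))
    where J = Invariant-↭ p I

-- The end of the game

module _ {P : Position n} (factor : FactorLabelling (client P)) where
  open FactorLabelling factor

  factor-possible : Proper P → Possible (waiter P) σ
  factor-possible proper = classes , All.tabulate λ {e} e∈w w →
    Proper.disjoint proper (Adj⇒∈ e (adjacent (src≢dst e) w)) e∈w

  -- Edges of other blocks have both ends in other blocks, hence do not meet `verts B`.
  head-Adj : ∀ {B Bs u v} → Invariant P (B ∷ Bs) → u ∈ verts B → Adj (client P) u v → Adj (edges B) u v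
  head-Adj {B} {Bs} {u} {v} I u∈ uv with Adj⇒Joins uv
  ... | e , e∈ , j with ∈-++⁻ (edges B) (∈-resp-↭ (↭-sym (edges↭ I)) e∈)
  head-Adj I u∈ uv | e , e∈ , inj₁ (refl , refl) | inj₁ e∈B = ∈⇒Adj e∈B
  head-Adj I u∈ uv | e , e∈ , inj₂ (refl , refl) | inj₁ e∈B = Adj-sym (∈⇒Adj e∈B)
  head-Adj {B} {Bs} {u} {v} I u∈ uv | e , e∈ , j | inj₂ e∈Bs with sound I
  ... | _ ∷ ss = ⊥-elim (proj₂ (proj₂ (Unique-++⁻ (verts B) (verts-unique I))) u∈ (joined j (Ends-concatMap Bs ss e∈Bs)))
    where
    Ends-concatMap : ∀ Bs → All (Sound (waiter P)) Bs → e ∈ concatMap edges Bs → Ends (concatMap verts Bs) e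
    Ends-concatMap (C ∷ Bs) (s ∷ ss) e∈ with ∈-++⁻ (edges C) e∈
    ... | inj₁ e∈C = let (a , b) = All.lookup (ends s) e∈C in ∈-++⁺ˡ a , ∈-++⁺ˡ b
    ... | inj₂ e∈Bs = let (a , b) = Ends-concatMap Bs ss e∈Bs in ∈-++⁺ʳ (verts C) a , ∈-++⁺ʳ (verts C) b
    joined : ∀ {V} → Joins e u v → Ends V e → u ∈ V
    joined (inj₁ (refl , _)) (s∈ , _) = s∈
    joined (inj₂ (refl , _)) (_ , d∈) = d∈

  -- With 3K vertices and 3K + W edges this reads K + r ≤ 2W + d, multiplied by three: the surplus
  -- 2W - K of a component is at least its waste minus its debt.
  head-bound : ∀ {B Bs} → Invariant P (B ∷ Bs) →
    7 * length (verts B) + 3 * waste B ≤ 6 * length (edges B) + 3 * debt B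
  head-bound {B} {Bs} I with sound I
  ... | s ∷ _ = goal
    where
    open ≤-Reasoning
    V = length (verts B)
    E = length (edges B)
    r = waste B
    w = crossing σ (edges B)
    F = inner σ (edges B)
    pσ = factor-possible (proper I)

    Adj-inner : ∀ {u v} → u ∈ verts B → u ≢ v → σ u ≡ σ v → Adj F u v
    Adj-inner u∈ u≢v eq with head-Adj I u∈ (adjacent u≢v eq)
    ... | inj₁ (p , e∈) = inj₁ (p , ∈-filter⁺ (within? σ) e∈ eq)
    ... | inj₂ (p , e∈) = inj₂ (p , ∈-filter⁺ (within? σ) e∈ (sym eq))

    -- Both partners of a vertex are neighbours by inner edges, so all inner degrees are at least
    -- two.
    V≤F : V ≤ length F
    V≤F = *-cancelˡ-≤ 2 (≤-trans
      (sum-map-≥ (degree F) 2 {verts B} (All.tabulate λ {v} v∈ →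
        let (p , q , p≢q , v≢p , v≢q , vp , vq) = partners v
        in two-members (∈-nbrs⁺ F (Adj-inner v∈ v≢p vp)) (∈-nbrs⁺ F (Adj-inner v∈ v≢q vq)) p≢q))
      (≤-reflexive (handshake (head-verts-unique I) (All.filter⁺ (within? σ) (ends s)))))

    V+w≤E : V + w ≤ E
    V+w≤E = ≤-trans (+-monoˡ-≤ w V≤F) (≤-reflexive (inner+crossing σ (edges B)))

    r≤w : r ≤ w
    r≤w = wasted s pσ

    V≤3w+3 : V ≤ 3 * suc w
    V≤3w+3 =
      let (L , L⊆ , sep , V≤3L) = representatives classes V (verts B) ≤-refl (head-verts-unique I)
      in ≤-trans V≤3L (*-monoʳ-≤ 3 (connected s σ L⊆ sep))

    split : ∀ V r → 7 * V + 3 * r ≡ 6 * V + (V + 3 * r)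
    split = solve-∀

    double : ∀ m → 3 * m + 3 * m ≡ 6 * m
    double = solve-∀

    enough : ∀ d → V + 3 * r ≤ 6 * w + 3 * d → 7 * V + 3 * r ≤ 6 * E + 3 * d
    enough d h = begin
      7 * V + 3 * r               ≡⟨ split V r ⟩
      6 * V + (V + 3 * r)         ≤⟨ +-monoʳ-≤ (6 * V) h ⟩
      6 * V + (6 * w + 3 * d)     ≡⟨ sym (+-assoc (6 * V) _ _) ⟩
      6 * V + 6 * w + 3 * d       ≡⟨ cong (_+ 3 * d) (sym (*-distribˡ-+ 6 V w)) ⟩
      6 * (V + w) + 3 * d         ≤⟨ +-monoˡ-≤ (3 * d) (*-monoʳ-≤ 6 V+w≤E) ⟩
      6 * E + 3 * d               ∎

    goal : 7 * V + 3 * r ≤ 6 * E + 3 * debt B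
    goal with w ≤? r | suc (3 * r) ≤? V
    -- Here K ≤ w + 1 and r + 1 ≤ w.
    ... | no w≰r | _ = enough (debt B) (begin
      V + 3 * r                 ≤⟨ +-monoˡ-≤ (3 * r) V≤3w+3 ⟩
      3 * suc w + 3 * r         ≡⟨ regroup w r ⟩
      3 * w + 3 * suc r         ≤⟨ +-monoʳ-≤ (3 * w) (*-monoʳ-≤ 3 (≰⇒> w≰r)) ⟩
      3 * w + 3 * w             ≡⟨ double w ⟩
      6 * w                     ≤⟨ m≤m+n _ _ ⟩
      6 * w + 3 * debt B        ∎)
      where
      regroup : ∀ w r → 3 * suc w + 3 * r ≡ 3 * w + 3 * suc r
      regroup = solve-∀
    -- Here K ≤ r ≤ w.
    ... | yes _ | no V≤3r = enough (debt B) (begin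
      V + 3 * r                 ≤⟨ +-mono-≤ (≤-pred (≰⇒> V≤3r)) ≤-refl ⟩
      3 * r + 3 * r             ≡⟨ double r ⟩
      6 * r                     ≤⟨ *-monoʳ-≤ 6 r≤w ⟩
      6 * w                     ≤⟨ m≤m+n _ _ ⟩
      6 * w + 3 * debt B        ∎)
    -- Now K ≤ w + 1 and r ≤ w fall short by one, but the block is cheap and its debt covers the
    -- difference.
    ... | yes w≤r | yes 3r<V = enough (debt B) (begin
      V + 3 * r                 ≤⟨ +-mono-≤ V≤3w+3 (*-monoʳ-≤ 3 r≤w) ⟩
      3 * suc w + 3 * w         ≡⟨ regroup w ⟩
      6 * w + 3 * 1             ≤⟨ +-monoʳ-≤ (6 * w) (*-monoʳ-≤ 3 (indebted s
                                     (3r<V , ≤-trans (+-monoʳ-≤ V r≤w) V+w≤E , σ , pσ , w≤r))) ⟩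
      6 * w + 3 * debt B        ∎)
      where
      regroup : ∀ w → 3 * suc w + 3 * w ≡ 6 * w + 3 * 1
      regroup = solve-∀

sum-bounds : ∀ {Bs : List (Block n)} →
  All (λ B → 7 * length (verts B) + 3 * waste B ≤ 6 * length (edges B) + 3 * debt B) Bs →
  7 * length (concatMap verts Bs) + 3 * sum (map waste Bs) ≤ 6 * length (concatMap edges Bs) + 3 * sum (map debt Bs)
sum-bounds [] = z≤n
sum-bounds {Bs = B ∷ Bs} (h ∷ hs) = begin
  7 * length (verts B ++ concatMap verts Bs) + 3 * (waste B + sum (map waste Bs))
    ≡⟨ cong (λ l → 7 * l + 3 * (waste B + sum (map waste Bs))) (length-++ (verts B)) ⟩
  7 * (length (verts B) + length (concatMap verts Bs)) + 3 * (waste B + sum (map waste Bs))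
    ≡⟨ distribute 7 (length (verts B)) _ (waste B) _ ⟩
  (7 * length (verts B) + 3 * waste B) + (7 * length (concatMap verts Bs) + 3 * sum (map waste Bs))
    ≤⟨ +-mono-≤ h (sum-bounds hs) ⟩
  (6 * length (edges B) + 3 * debt B) + (6 * length (concatMap edges Bs) + 3 * sum (map debt Bs))
    ≡⟨ sym (distribute 6 (length (edges B)) _ (debt B) _) ⟩
  6 * (length (edges B) + length (concatMap edges Bs)) + 3 * (debt B + sum (map debt Bs))
    ≡⟨ cong (λ l → 6 * l + 3 * (debt B + sum (map debt Bs))) (sym (length-++ (edges B))) ⟩
  6 * length (edges B ++ concatMap edges Bs) + 3 * (debt B + sum (map debt Bs)) ∎
  where
  open ≤-Reasoning
  distribute : ∀ k a b c d → k * (a + b) + 3 * (c + d) ≡ (k * a + 3 * c) + (k * b + 3 * d)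
  distribute = solve-∀

-- Sum the bounds of all blocks; `balance` replaces total debt by total waste, which cancels.
factor-bound : ∀ {P : Position n} → ∃ (Invariant P) → HasK3Factor (client P) → 7 * n ≤ 6 * length (client P)
factor-bound {n} {P} (Bs , I) factor = +-cancelʳ-≤ (3 * sum (map waste Bs)) _ _ (begin
  7 * n + 3 * sum (map waste Bs)
    ≡⟨ cong (λ l → 7 * l + 3 * sum (map waste Bs)) (sym (trans (↭-length (verts↭ I)) (length-tabulate {n = n} id))) ⟩
  7 * length (concatMap verts Bs) + 3 * sum (map waste Bs)
    ≤⟨ sum-bounds (All.tabulate λ B∈ → head-bound (factor-labelling factor) (Invariant-↭ (proj₂ (∈⇒↭ B∈)) I)) ⟩
  6 * length (concatMap edges Bs) + 3 * sum (map debt Bs)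
    ≤⟨ +-mono-≤ (≤-reflexive (cong (6 *_) (↭-length (edges↭ I)))) (*-monoʳ-≤ 3 (balance I)) ⟩
  6 * length (client P) + 3 * sum (map waste Bs) ∎)
  where open ≤-Reasoning

initial-invariant : ∀ n → ∃ (Invariant (initial n))
initial-invariant n = map singleton (allFin n) , record
  { proper = record { unique = [] ; disjoint = λ () }
  ; sound = All.map⁺ (All.tabulate λ {v} _ → record
      { ends = [] ; connected = singleton-connected v ; wasted = λ _ → z≤n ; indebted = λ { (_ , () , _) } })
  ; verts↭ = ↭-reflexive (all-verts (allFin n))
  ; edges↭ = ↭-reflexive (no-edges (allFin n))
  ; balance = ≤-reflexive (same-sums (allFin n)) }
  where
  singleton : Fin n → Block n
  singleton v = block (v ∷ []) [] 0 0
  all-verts : ∀ L → concatMap verts (map singleton L) ≡ L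
  all-verts [] = refl
  all-verts (v ∷ L) = cong (v ∷_) (all-verts L)
  no-edges : ∀ L → concatMap edges (map singleton L) ≡ []
  no-edges [] = refl
  no-edges (v ∷ L) = no-edges L
  same-sums : ∀ L → sum (map debt (map singleton L)) ≡ sum (map waste (map singleton L))
  same-sums [] = refl
  same-sums (v ∷ L) = same-sums L

-- Induction along Waiter's strategy: each round lowers `k` by one and gives Client one edge, so the
-- right-hand side is constant.
rounds-bound : ∀ {k} {P : Position n} → ∃ (Invariant P) → WaiterWinsWithin k P → 7 * n ≤ 6 * (k + length (client P))
rounds-bound {k = k} I (done factor) = ≤-trans (factor-bound I factor) (*-monoʳ-≤ 6 (m≤n+m _ k))
-- The goal is a decidable inequality, which discharges the double negation of `client-reply`.
rounds-bound {n} {suc k} {P} I (offer e f e≢f e-free f-free win-e win-f) = decidable-stable (_ ≤? _) λ ¬goal →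
  client-reply I e≢f e-free f-free λ
    { (inj₁ J) → ¬goal (next (rounds-bound J win-e))
    ; (inj₂ J) → ¬goal (next (rounds-bound J win-f)) }
  where
  next : 7 * n ≤ 6 * (k + suc (length (client P))) → 7 * n ≤ 6 * (suc k + length (client P))
  next = subst (λ m → 7 * n ≤ 6 * m) (+-suc k (length (client P)))

theorem1p2 : (n : ℕ) → 3 ∣ n → WaiterWins n →
    (t : ℕ) → IsTauWC n t → 7 * n ≤ 6 * t
theorem1p2 n _ _ t (wins , _) =
  subst (λ m → 7 * n ≤ 6 * m) (+-identityʳ t) (rounds-bound (initial-invariant n) wins)
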